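{- There do not exist $k\in\mathbb{N}$ and a $k$-color edge coloring model $h\in(SV_k)^*$ such that $p_h(G)=p(G;0)$ for all graphs $G$ (having no component equal to the circle $\bigcirc$), where $p(G;t)=\det(tI-A)$ is the characteristic polynomial of $G$.
   Context: $\mathbb{N}=\mathbb{Z}_{\ge 0}$ and $[k]=\{1,\dots,k\}$. All graphs are finite and may have loops and multiple edges. The circle $\bigcirc$ is the graph consisting of a single edge with empty vertex set; graphs here are assumed not to have $\bigcirc$ as a connected component. The adjacency matrix $A$ of a graph $G=(V,E)$ is the $V\times V$ matrix for which $A(i,j)$, $i\ne j$, is the multiplicity of the edge $\{i,j\}$ in $E$, and $A(i,i)$ is twice the number of loops at $i$. The characteristic polynomial is $p(G;t):=\det(tI-A)$. $V_k$ is a complex vector space with basis $e_1,\dots,e_k$ and $SV_k$ is its symmetric algebra, with product written $\odot$ (the empty product being $1$). A $k$-color edge coloring model is an element $h$ of the full linear dual $(SV_k)^*$. Its partition function $p_h$ is defined for a graph $G=(V,E)$ by $$p_h(G):=\sum_{\phi:E\to[k]}\prod_{v\in V}h\Big(\bigodot_{a\in\delta(v)}e_{\phi(a)}\Big),$$ where $\delta(v)$ is the collection of edges incident with $v$, a loop at $v$ occurring twice. -}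

module Defs where

open import Algebra.Bundles using (CommutativeRing; Semiring)
import Algebra.Definitions.RawMonoid as RawMonoidDefs
import Algebra.Definitions.RawSemiring as RawSemiringDefs
open import Algebra.Module.Bundles using (Module)
import Algebra.Module.Construct.TensorUnit as TensorUnit
open import Algebra.Module.Morphism.Structures using (module ModuleMorphisms)
open import Algebra.Module.Structures using (IsModule; IsLeftModule)
open import Algebra.Module.Structures.Biased using (IsModuleFromLeft)
open import Data.Fin.Base using (Fin; zero; suc; toℕ; punchIn)
import Data.Fin.Properties as Fin
open import Data.List.Base using (List; []; _∷_; allFin; concatMap; filter; foldr; length; map)
open import Data.Nat.Base as ℕ using (ℕ; zero; suc)
import Data.Nat.Properties as ℕ
open import Data.Product.Base using (∃; Σ; _×_; _,_; proj₁; proj₂)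
open import Data.Product.Properties using (≡-dec)
open import Data.Rational.Base as ℚ using (ℚ; 0ℚ; 1ℚ; ½)
import Data.Rational.Properties as ℚ
open import Data.Rational.Solver using (module +-*-Solver)
open import Data.Sum.Base using (_⊎_)
open import Data.Vec.Functional as Vector using (Vector)
open import Level using (Level; 0ℓ; _⊔_)
open import Relation.Binary.PropositionalEquality
  using (_≡_; refl; sym; trans; cong; cong₂; subst; subst₂)
open import Relation.Binary.Structures using (IsEquivalence)
open import Relation.Nullary.Decidable using (Dec; yes; no; _⊎-dec_)

-- Cauchy sequences of rationals, considered up to null sequences (_≈ℝ_).
-- The modulus of convergence is part of the data, so no choice principle
-- is needed to work with it.  With eta, comparing two reals would compare
-- their Cauchy proofs, which is prohibitively slow.
record ℝ : Set where
  no-eta-equality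
  constructor mkℝ
  field
    seq    : ℕ → ℚ
    cauchy : ∀ ε → 0ℚ ℚ.< ε →
             ∃ λ N → ∀ m n → N ℕ.≤ m → N ℕ.≤ n → ℚ.∣ seq m ℚ.- seq n ∣ ℚ.< ε

open ℝ public

infix 4 _≈ℝ_

record _≈ℝ_ (x y : ℝ) : Set where
  constructor mk≈
  field
    null : ∀ ε → 0ℚ ℚ.< ε →
           ∃ λ N → ∀ n → N ℕ.≤ n → ℚ.∣ seq x n ℚ.- seq y n ∣ ℚ.< ε

open _≈ℝ_ public

private
  half : ∀ {ε} → 0ℚ ℚ.< ε → 0ℚ ℚ.< ε ℚ.* ½
  half {ε} ε>0 = subst (ℚ._< ε ℚ.* ½) (ℚ.*-zeroˡ ½) (ℚ.*-monoˡ-<-pos ½ ε>0)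

  half+half : ∀ ε → ε ℚ.* ½ ℚ.+ ε ℚ.* ½ ≡ ε
  half+half ε = trans (sym (ℚ.*-distribˡ-+ ε ½ ½)) (ℚ.*-identityʳ ε)

  <-halves : ∀ {ε p q r} → r ℚ.≤ p ℚ.+ q → p ℚ.< ε ℚ.* ½ → q ℚ.< ε ℚ.* ½ → r ℚ.< ε
  <-halves {ε} r≤p+q p< q< =
    ℚ.≤-<-trans r≤p+q (subst (_ ℚ.<_) (half+half ε) (ℚ.+-mono-< p< q<))

  dist-+ : ∀ a b c d →
    ℚ.∣ (a ℚ.+ b) ℚ.- (c ℚ.+ d) ∣ ℚ.≤ ℚ.∣ a ℚ.- c ∣ ℚ.+ ℚ.∣ b ℚ.- d ∣
  dist-+ a b c d =
    subst (ℚ._≤ ℚ.∣ a ℚ.- c ∣ ℚ.+ ℚ.∣ b ℚ.- d ∣)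
      (cong ℚ.∣_∣ (solve 4 (λ a b c d →
        (a :- c) :+ (b :- d) := (a :+ b) :- (c :+ d)) refl a b c d))
      (ℚ.∣p+q∣≤∣p∣+∣q∣ (a ℚ.- c) (b ℚ.- d))
    where open +-*-Solver

  dist-neg : ∀ a b → ℚ.∣ a ℚ.- b ∣ ≡ ℚ.∣ ℚ.- a ℚ.- ℚ.- b ∣
  dist-neg a b = trans (sym (ℚ.∣-p∣≡∣p∣ (a ℚ.- b)))
    (cong ℚ.∣_∣ (solve 2 (λ a b → :- (a :- b) := :- a :- :- b) refl a b))
    where open +-*-Solver

  dist-sym : ∀ a b → ℚ.∣ a ℚ.- b ∣ ≡ ℚ.∣ b ℚ.- a ∣
  dist-sym a b = trans (sym (ℚ.∣-p∣≡∣p∣ (a ℚ.- b)))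
    (cong ℚ.∣_∣ (solve 2 (λ a b → :- (a :- b) := b :- a) refl a b))
    where open +-*-Solver

  dist-trans : ∀ a b c → ℚ.∣ a ℚ.- c ∣ ℚ.≤ ℚ.∣ a ℚ.- b ∣ ℚ.+ ℚ.∣ b ℚ.- c ∣
  dist-trans a b c =
    subst (ℚ._≤ ℚ.∣ a ℚ.- b ∣ ℚ.+ ℚ.∣ b ℚ.- c ∣)
      (cong ℚ.∣_∣ (solve 3 (λ a b c → (a :- b) :+ (b :- c) := a :- c) refl a b c))
      (ℚ.∣p+q∣≤∣p∣+∣q∣ (a ℚ.- b) (b ℚ.- c))
    where open +-*-Solver

  dist-* : ∀ a b c d →
    ℚ.∣ a ℚ.* b ℚ.- c ℚ.* d ∣ ℚ.≤ ℚ.∣ a ℚ.* (b ℚ.- d) ∣ ℚ.+ ℚ.∣ d ℚ.* (a ℚ.- c) ∣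
  dist-* a b c d =
    subst (ℚ._≤ ℚ.∣ a ℚ.* (b ℚ.- d) ∣ ℚ.+ ℚ.∣ d ℚ.* (a ℚ.- c) ∣)
      (cong ℚ.∣_∣ (solve 4 (λ a b c d →
        a :* (b :- d) :+ d :* (a :- c) := a :* b :- c :* d) refl a b c d))
      (ℚ.∣p+q∣≤∣p∣+∣q∣ (a ℚ.* (b ℚ.- d)) (d ℚ.* (a ℚ.- c)))
    where open +-*-Solver

  bounded : ∀ x → ∃ λ B → 0ℚ ℚ.< B × ∃ λ N → ∀ n → N ℕ.≤ n → ℚ.∣ seq x n ∣ ℚ.≤ B
  bounded x with cauchy x 1ℚ (ℚ.positive⁻¹ 1ℚ)
  ... | N , close =
    1ℚ ℚ.+ ℚ.∣ seq x N ∣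
    , ℚ.+-mono-<-≤ {0ℚ} {1ℚ} (ℚ.positive⁻¹ 1ℚ) (ℚ.0≤∣p∣ (seq x N))
    , N
    , λ n N≤n → subst (ℚ._≤ 1ℚ ℚ.+ ℚ.∣ seq x N ∣)
        (cong ℚ.∣_∣ (solve 2 (λ a b → (a :- b) :+ b := a) refl (seq x n) (seq x N)))
        (ℚ.≤-trans (ℚ.∣p+q∣≤∣p∣+∣q∣ (seq x n ℚ.- seq x N) (seq x N))
          (ℚ.+-monoˡ-≤ ℚ.∣ seq x N ∣ (ℚ.<⇒≤ (close n N N≤n ℕ.≤-refl))))
    where open +-*-Solver

  small-* : ∀ B ε → 0ℚ ℚ.< B → 0ℚ ℚ.< ε → ∃ λ δ → 0ℚ ℚ.< δ ×
            (∀ u v → ℚ.∣ u ∣ ℚ.≤ B → ℚ.∣ v ∣ ℚ.< δ → ℚ.∣ u ℚ.* v ∣ ℚ.< ε)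
  small-* B ε B>0 ε>0 = δ , δ>0 , bound
    where
    instance
      B⁺ = ℚ.positive B>0
      ε⁺ = ℚ.positive ε>0
      B≢0 = ℚ.pos⇒nonZero B
      B⁻¹⁺ = ℚ.1/pos⇒pos B
    δ = ε ℚ.* (ℚ.1/ B)
    δ>0 : 0ℚ ℚ.< δ
    δ>0 = ℚ.positive⁻¹ δ {{ℚ.pos*pos⇒pos ε (ℚ.1/ B)}}
    Bδ≡ε : B ℚ.* δ ≡ ε
    Bδ≡ε = trans (solve 3 (λ b e i → b :* (e :* i) := e :* (b :* i)) refl B ε (ℚ.1/ B))
      (trans (cong (ε ℚ.*_) (ℚ.*-inverseʳ B)) (ℚ.*-identityʳ ε))
      where open +-*-Solver
    bound : ∀ u v → ℚ.∣ u ∣ ℚ.≤ B → ℚ.∣ v ∣ ℚ.< δ → ℚ.∣ u ℚ.* v ∣ ℚ.< ε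
    bound u v u≤B v<δ = subst₂ ℚ._<_ (sym (ℚ.∣p*q∣≡∣p∣*∣q∣ u v)) Bδ≡ε
      (ℚ.≤-<-trans (ℚ.*-monoʳ-≤-nonNeg ℚ.∣ v ∣ {{ℚ.∣-∣-nonNeg v}} u≤B)
        (ℚ.*-monoʳ-<-pos B v<δ))

  ⊔ˡ : ∀ {a b n} → a ℕ.⊔ b ℕ.≤ n → a ℕ.≤ n
  ⊔ˡ {a} {b} = ℕ.m⊔n≤o⇒m≤o a b

  ⊔ʳ : ∀ {a b n} → a ℕ.⊔ b ℕ.≤ n → b ℕ.≤ n
  ⊔ʳ {a} {b} = ℕ.m⊔n≤o⇒n≤o a b

infixl 6 _+ℝ_
infixl 7 _*ℝ_
infix  8 -ℝ_

0ℝ 1ℝ : ℝ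
0ℝ = mkℝ (λ _ → 0ℚ) (λ ε ε>0 → 0 , λ _ _ _ _ → ε>0)
1ℝ = mkℝ (λ _ → 1ℚ) (λ ε ε>0 → 0 , λ _ _ _ _ → ε>0)

_+ℝ_ : ℝ → ℝ → ℝ
seq    (x +ℝ y) n = seq x n ℚ.+ seq y n
cauchy (x +ℝ y) ε ε>0 =
  let M , p = cauchy x (ε ℚ.* ½) (half ε>0)
      N , q = cauchy y (ε ℚ.* ½) (half ε>0)
  in M ℕ.⊔ N , λ m n ≤m ≤n →
    <-halves {ε} (dist-+ (seq x m) (seq y m) (seq x n) (seq y n))
      (p m n (⊔ˡ ≤m) (⊔ˡ ≤n)) (q m n (⊔ʳ {M} ≤m) (⊔ʳ {M} ≤n))

-ℝ_ : ℝ → ℝ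
seq    (-ℝ x) n = ℚ.- seq x n
cauchy (-ℝ x) ε ε>0 =
  let N , p = cauchy x ε ε>0
  in N , λ m n ≤m ≤n →
    subst (ℚ._< ε) (dist-neg (seq x m) (seq x n)) (p m n ≤m ≤n)

_*ℝ_ : ℝ → ℝ → ℝ
seq    (x *ℝ y) n = seq x n ℚ.* seq y n
cauchy (x *ℝ y) ε ε>0 =
  let A , A>0 , K , x≤A = bounded x
      B , B>0 , L , y≤B = bounded y
      δ , δ>0 , s = small-* A (ε ℚ.* ½) A>0 (half ε>0)
      η , η>0 , t = small-* B (ε ℚ.* ½) B>0 (half ε>0)
      M , p = cauchy x η η>0
      N , q = cauchy y δ δ>0
  in (K ℕ.⊔ L) ℕ.⊔ (M ℕ.⊔ N) , λ m n ≤m ≤n →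
    <-halves {ε} (dist-* (seq x m) (seq y m) (seq x n) (seq y n))
      (s (seq x m) _ (x≤A m (⊔ˡ (⊔ˡ ≤m)))
        (q m n (⊔ʳ {M} (⊔ʳ {K ℕ.⊔ L} ≤m)) (⊔ʳ {M} (⊔ʳ {K ℕ.⊔ L} ≤n))))
      (t (seq y n) _ (y≤B n (⊔ʳ {K} (⊔ˡ ≤n)))
        (p m n (⊔ˡ (⊔ʳ {K ℕ.⊔ L} ≤m)) (⊔ˡ (⊔ʳ {K ℕ.⊔ L} ≤n))))

private
  pointwise : ∀ {x y} → (∀ n → seq x n ≡ seq y n) → x ≈ℝ y
  pointwise {x} {y} eq .null ε ε>0 = 0 , λ n _ →
    subst (λ q → ℚ.∣ q ∣ ℚ.< ε)
      (sym (trans (cong (ℚ._- seq y n) (eq n)) (ℚ.+-inverseʳ (seq y n)))) ε>0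

  ≈ℝ-isEquivalence : IsEquivalence _≈ℝ_
  ≈ℝ-isEquivalence = record
    { refl  = pointwise (λ _ → refl)
    ; sym   = λ {x} {y} x≈y → mk≈ λ ε ε>0 →
        let N , p = null x≈y ε ε>0
        in N , λ n ≤n → subst (ℚ._< ε) (dist-sym (seq x n) (seq y n)) (p n ≤n)
    ; trans = λ {x} {y} {z} x≈y y≈z → mk≈ λ ε ε>0 →
        let M , p = null x≈y (ε ℚ.* ½) (half ε>0)
            N , q = null y≈z (ε ℚ.* ½) (half ε>0)
        in M ℕ.⊔ N , λ n ≤n →
          <-halves {ε} (dist-trans (seq x n) (seq y n) (seq z n))
            (p n (⊔ˡ ≤n)) (q n (⊔ʳ {M} ≤n))
    }

  +ℝ-cong : ∀ {x x′ y y′} → x ≈ℝ x′ → y ≈ℝ y′ → x +ℝ y ≈ℝ x′ +ℝ y′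
  +ℝ-cong {x} {x′} {y} {y′} x≈ y≈ .null ε ε>0 =
    let M , p = null x≈ (ε ℚ.* ½) (half ε>0)
        N , q = null y≈ (ε ℚ.* ½) (half ε>0)
    in M ℕ.⊔ N , λ n ≤n →
      <-halves {ε} (dist-+ (seq x n) (seq y n) (seq x′ n) (seq y′ n))
        (p n (⊔ˡ ≤n)) (q n (⊔ʳ {M} ≤n))

  -ℝ-cong : ∀ {x y} → x ≈ℝ y → -ℝ x ≈ℝ -ℝ y
  -ℝ-cong {x} {y} x≈y .null ε ε>0 =
    let N , p = null x≈y ε ε>0
    in N , λ n ≤n → subst (ℚ._< ε) (dist-neg (seq x n) (seq y n)) (p n ≤n)

  *ℝ-cong : ∀ {x x′ y y′} → x ≈ℝ x′ → y ≈ℝ y′ → x *ℝ y ≈ℝ x′ *ℝ y′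
  *ℝ-cong {x} {x′} {y} {y′} x≈ y≈ .null ε ε>0 =
    let A , A>0 , K , x≤A = bounded x
        B , B>0 , L , y≤B = bounded y′
        δ , δ>0 , s = small-* A (ε ℚ.* ½) A>0 (half ε>0)
        η , η>0 , t = small-* B (ε ℚ.* ½) B>0 (half ε>0)
        M , p = null x≈ η η>0
        N , q = null y≈ δ δ>0
    in (K ℕ.⊔ L) ℕ.⊔ (M ℕ.⊔ N) , λ n ≤n →
      <-halves {ε} (dist-* (seq x n) (seq y n) (seq x′ n) (seq y′ n))
        (s (seq x n) _ (x≤A n (⊔ˡ (⊔ˡ ≤n))) (q n (⊔ʳ {M} (⊔ʳ {K ℕ.⊔ L} ≤n))))
        (t (seq y′ n) _ (y≤B n (⊔ʳ {K} (⊔ˡ ≤n))) (p n (⊔ˡ (⊔ʳ {K ℕ.⊔ L} ≤n))))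

infixl 6 _+ℂ_
infixl 7 _*ℂ_
infix  8 -ℂ_
infix  4 _≈ℂ_

record ℂ : Set where
  constructor _+i_
  field
    re im : ℝ

open ℂ public

record _≈ℂ_ (z w : ℂ) : Set where
  constructor _+i_
  field
    re≈ : re z ≈ℝ re w
    im≈ : im z ≈ℝ im w

open _≈ℂ_ public

0ℂ 1ℂ : ℂ
0ℂ = 0ℝ +i 0ℝ
1ℂ = 1ℝ +i 0ℝ

_+ℂ_ _*ℂ_ : ℂ → ℂ → ℂ
z +ℂ w = (re z +ℝ re w) +i (im z +ℝ im w)
z *ℂ w = (re z *ℝ re w +ℝ -ℝ (im z *ℝ im w)) +i (re z *ℝ im w +ℝ im z *ℝ re w)

-ℂ_ : ℂ → ℂ
-ℂ z = (-ℝ re z) +i (-ℝ im z)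

private
  module ℂ-Laws where
    open +-*-Solver

    *-assoc-re : ∀ a b c d e f →
      (a ℚ.* c ℚ.- (b ℚ.* d)) ℚ.* e ℚ.- ((a ℚ.* d ℚ.+ b ℚ.* c) ℚ.* f) ≡
      a ℚ.* (c ℚ.* e ℚ.- (d ℚ.* f)) ℚ.- (b ℚ.* (c ℚ.* f ℚ.+ d ℚ.* e))
    *-assoc-re = solve 6 (λ a b c d e f →
      (a :* c :- (b :* d)) :* e :- ((a :* d :+ b :* c) :* f) :=
      a :* (c :* e :- (d :* f)) :- (b :* (c :* f :+ d :* e))) refl

    *-assoc-im : ∀ a b c d e f →
      (a ℚ.* c ℚ.- (b ℚ.* d)) ℚ.* f ℚ.+ (a ℚ.* d ℚ.+ b ℚ.* c) ℚ.* e ≡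
      a ℚ.* (c ℚ.* f ℚ.+ d ℚ.* e) ℚ.+ b ℚ.* (c ℚ.* e ℚ.- (d ℚ.* f))
    *-assoc-im = solve 6 (λ a b c d e f →
      (a :* c :- (b :* d)) :* f :+ (a :* d :+ b :* c) :* e :=
      a :* (c :* f :+ d :* e) :+ b :* (c :* e :- (d :* f))) refl

    *-identityˡ-re : ∀ a b →
      1ℚ ℚ.* a ℚ.- (0ℚ ℚ.* b) ≡
      a
    *-identityˡ-re = solve 2 (λ a b →
      con 1ℚ :* a :- (con 0ℚ :* b) :=
      a) refl

    *-identityˡ-im : ∀ a b →
      1ℚ ℚ.* b ℚ.+ 0ℚ ℚ.* a ≡
      b
    *-identityˡ-im = solve 2 (λ a b →
      con 1ℚ :* b :+ con 0ℚ :* a :=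
      b) refl

    *-identityʳ-re : ∀ a b →
      a ℚ.* 1ℚ ℚ.- (b ℚ.* 0ℚ) ≡
      a
    *-identityʳ-re = solve 2 (λ a b →
      a :* con 1ℚ :- (b :* con 0ℚ) :=
      a) refl

    *-identityʳ-im : ∀ a b →
      a ℚ.* 0ℚ ℚ.+ b ℚ.* 1ℚ ≡
      b
    *-identityʳ-im = solve 2 (λ a b →
      a :* con 0ℚ :+ b :* con 1ℚ :=
      b) refl

    distribˡ-re : ∀ a b c d e f →
      a ℚ.* (c ℚ.+ e) ℚ.- (b ℚ.* (d ℚ.+ f)) ≡
      (a ℚ.* c ℚ.- (b ℚ.* d)) ℚ.+ (a ℚ.* e ℚ.- (b ℚ.* f))
    distribˡ-re = solve 6 (λ a b c d e f →
      a :* (c :+ e) :- (b :* (d :+ f)) :=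
      (a :* c :- (b :* d)) :+ (a :* e :- (b :* f))) refl

    distribˡ-im : ∀ a b c d e f →
      a ℚ.* (d ℚ.+ f) ℚ.+ b ℚ.* (c ℚ.+ e) ≡
      (a ℚ.* d ℚ.+ b ℚ.* c) ℚ.+ (a ℚ.* f ℚ.+ b ℚ.* e)
    distribˡ-im = solve 6 (λ a b c d e f →
      a :* (d :+ f) :+ b :* (c :+ e) :=
      (a :* d :+ b :* c) :+ (a :* f :+ b :* e)) refl

    distribʳ-re : ∀ a b c d e f →
      (c ℚ.+ e) ℚ.* a ℚ.- ((d ℚ.+ f) ℚ.* b) ≡
      (c ℚ.* a ℚ.- (d ℚ.* b)) ℚ.+ (e ℚ.* a ℚ.- (f ℚ.* b))
    distribʳ-re = solve 6 (λ a b c d e f →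
      (c :+ e) :* a :- ((d :+ f) :* b) :=
      (c :* a :- (d :* b)) :+ (e :* a :- (f :* b))) refl

    distribʳ-im : ∀ a b c d e f →
      (c ℚ.+ e) ℚ.* b ℚ.+ (d ℚ.+ f) ℚ.* a ≡
      (c ℚ.* b ℚ.+ d ℚ.* a) ℚ.+ (e ℚ.* b ℚ.+ f ℚ.* a)
    distribʳ-im = solve 6 (λ a b c d e f →
      (c :+ e) :* b :+ (d :+ f) :* a :=
      (c :* b :+ d :* a) :+ (e :* b :+ f :* a)) refl

    *-comm-re : ∀ a b c d →
      a ℚ.* c ℚ.- (b ℚ.* d) ≡
      c ℚ.* a ℚ.- (d ℚ.* b)
    *-comm-re = solve 4 (λ a b c d →
      a :* c :- (b :* d) :=
      c :* a :- (d :* b)) refl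

    *-comm-im : ∀ a b c d →
      a ℚ.* d ℚ.+ b ℚ.* c ≡
      c ℚ.* b ℚ.+ d ℚ.* a
    *-comm-im = solve 4 (λ a b c d →
      a :* d :+ b :* c :=
      c :* b :+ d :* a) refl

ℂ-commutativeRing : CommutativeRing 0ℓ 0ℓ
ℂ-commutativeRing = record
  { Carrier = ℂ
  ; _≈_     = _≈ℂ_
  ; _+_     = _+ℂ_
  ; _*_     = _*ℂ_
  ; -_      = -ℂ_
  ; 0#      = 0ℂ
  ; 1#      = 1ℂ
  ; isCommutativeRing = record
    { isRing = record
      { +-isAbelianGroup = record
        { isGroup = record
          { isMonoid = record
            { isSemigroup = record
              { isMagma = record
                { isEquivalence = record
                  { refl  = ≈ℝ.refl +i ≈ℝ.refl
                  ; sym   = λ p → ≈ℝ.sym (re≈ p) +i ≈ℝ.sym (im≈ p)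
                  ; trans = λ p q → ≈ℝ.trans (re≈ p) (re≈ q) +i ≈ℝ.trans (im≈ p) (im≈ q)
                  }
                ; ∙-cong = λ p q → +ℝ-cong (re≈ p) (re≈ q) +i +ℝ-cong (im≈ p) (im≈ q)
                }
              ; assoc = λ x y z →
                    pointwise (λ n → ℚ.+-assoc (Re x n) (Re y n) (Re z n))
                 +i pointwise (λ n → ℚ.+-assoc (Im x n) (Im y n) (Im z n))
              }
            ; identity = +-identityˡ , λ x →
                    pointwise (λ n → ℚ.+-identityʳ (Re x n))
                 +i pointwise (λ n → ℚ.+-identityʳ (Im x n))
            }
          ; inverse =
              (λ x → pointwise (λ n → ℚ.+-inverseˡ (Re x n))
                  +i pointwise (λ n → ℚ.+-inverseˡ (Im x n)))
            , (λ x → pointwise (λ n → ℚ.+-inverseʳ (Re x n))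
                  +i pointwise (λ n → ℚ.+-inverseʳ (Im x n)))
          ; ⁻¹-cong = λ p → -ℝ-cong (re≈ p) +i -ℝ-cong (im≈ p)
          }
        ; comm = λ x y →
                    pointwise (λ n → ℚ.+-comm (Re x n) (Re y n))
                 +i pointwise (λ n → ℚ.+-comm (Im x n) (Im y n))
        }
      ; *-cong = λ p q →
             +ℝ-cong (*ℝ-cong (re≈ p) (re≈ q)) (-ℝ-cong (*ℝ-cong (im≈ p) (im≈ q)))
          +i +ℝ-cong (*ℝ-cong (re≈ p) (im≈ q)) (*ℝ-cong (im≈ p) (re≈ q))
      ; *-assoc = λ x y z →
             pointwise (λ n → *-assoc-re (Re x n) (Im x n) (Re y n) (Im y n) (Re z n) (Im z n))
          +i pointwise (λ n → *-assoc-im (Re x n) (Im x n) (Re y n) (Im y n) (Re z n) (Im z n))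
      ; *-identity =
          (λ x → pointwise (λ n → *-identityˡ-re (Re x n) (Im x n))
              +i pointwise (λ n → *-identityˡ-im (Re x n) (Im x n)))
        , (λ x → pointwise (λ n → *-identityʳ-re (Re x n) (Im x n))
              +i pointwise (λ n → *-identityʳ-im (Re x n) (Im x n)))
      ; distrib =
          (λ x y z →
             pointwise (λ n → distribˡ-re (Re x n) (Im x n) (Re y n) (Im y n) (Re z n) (Im z n))
          +i pointwise (λ n → distribˡ-im (Re x n) (Im x n) (Re y n) (Im y n) (Re z n) (Im z n)))
        , (λ x y z →
             pointwise (λ n → distribʳ-re (Re x n) (Im x n) (Re y n) (Im y n) (Re z n) (Im z n))
          +i pointwise (λ n → distribʳ-im (Re x n) (Im x n) (Re y n) (Im y n) (Re z n) (Im z n)))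
      }
    ; *-comm = λ x y →
             pointwise (λ n → *-comm-re (Re x n) (Im x n) (Re y n) (Im y n))
          +i pointwise (λ n → *-comm-im (Re x n) (Im x n) (Re y n) (Im y n))
    }
  }
  where
  open ℂ-Laws
  module ≈ℝ = IsEquivalence ≈ℝ-isEquivalence
  Re Im : ℂ → ℕ → ℚ
  Re z = seq (re z)
  Im z = seq (im z)
  +-identityˡ : ∀ x → 0ℂ +ℂ x ≈ℂ x
  +-identityˡ x = pointwise (λ n → ℚ.+-identityˡ (Re x n))
               +i pointwise (λ n → ℚ.+-identityˡ (Im x n))

-- Loops and multiple edges are allowed.  The two ends of an edge are
-- listed in an arbitrary order.  Since every edge has ends, the
-- vertexless circle cannot occur as a component.
record Graph : Set where
  field
    ∣V∣ ∣E∣ : ℕ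
    ends    : Fin ∣E∣ → Fin ∣V∣ × Fin ∣V∣

  Joins : Fin ∣V∣ → Fin ∣V∣ → Fin ∣E∣ → Set
  Joins i j a = ends a ≡ (i , j) ⊎ ends a ≡ (j , i)

  joins? : ∀ i j a → Dec (Joins i j a)
  joins? i j a = ≡-dec Fin._≟_ Fin._≟_ (ends a) (i , j)
           ⊎-dec ≡-dec Fin._≟_ Fin._≟_ (ends a) (j , i)

  multiplicity : Fin ∣V∣ → Fin ∣V∣ → ℕ
  multiplicity i j = length (filter (joins? i j) (allFin ∣E∣))

  adjacency : Fin ∣V∣ → Fin ∣V∣ → ℕ
  adjacency i j with i Fin.≟ j
  ... | yes _ = 2 ℕ.* multiplicity i i
  ... | no  _ = multiplicity i j

  -- An edge is listed once for each of its ends equal to v, so a loop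
  -- at v is listed twice.
  δ : Fin ∣V∣ → List (Fin ∣E∣)
  δ v = concatMap
    (λ a → map (λ _ → a) (filter (Fin._≟ v) (proj₁ (ends a) ∷ proj₂ (ends a) ∷ [])))
    (allFin ∣E∣)

module _ {c ℓ m ℓm : Level} {R : CommutativeRing c ℓ} (M : Module R m ℓm) where

  private
    module R = CommutativeRing R
    module M = Module M

  infixl 6 _⊕_
  infixl 7 _⊙_
  infix  4 _∼_

  -- The free commutative R-algebra on a linear map out of M: terms
  -- modulo the congruence generated by the axioms.

  data Sym : Set (c ⊔ m) where
    con     : R.Carrier → Sym
    ι       : M.Carrierᴹ → Sym
    _⊕_ _⊙_ : Sym → Sym → Sym

  data _∼_ : Sym → Sym → Set (c ⊔ ℓ ⊔ m ⊔ ℓm) where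
    ∼-refl      : ∀ {x} → x ∼ x
    ∼-sym       : ∀ {x y} → x ∼ y → y ∼ x
    ∼-trans     : ∀ {x y z} → x ∼ y → y ∼ z → x ∼ z
    con-cong    : ∀ {a b} → a R.≈ b → con a ∼ con b
    ι-cong      : ∀ {u v} → u M.≈ᴹ v → ι u ∼ ι v
    ⊕-cong      : ∀ {x x′ y y′} → x ∼ x′ → y ∼ y′ → x ⊕ y ∼ x′ ⊕ y′
    ⊙-cong      : ∀ {x x′ y y′} → x ∼ x′ → y ∼ y′ → x ⊙ y ∼ x′ ⊙ y′
    ⊕-assoc     : ∀ x y z → (x ⊕ y) ⊕ z ∼ x ⊕ (y ⊕ z)
    ⊕-comm      : ∀ x y → x ⊕ y ∼ y ⊕ x
    ⊕-identityˡ : ∀ x → con R.0# ⊕ x ∼ x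
    ⊙-assoc     : ∀ x y z → (x ⊙ y) ⊙ z ∼ x ⊙ (y ⊙ z)
    ⊙-comm      : ∀ x y → x ⊙ y ∼ y ⊙ x
    ⊙-identityˡ : ∀ x → con R.1# ⊙ x ∼ x
    ⊙-zeroˡ     : ∀ x → con R.0# ⊙ x ∼ con R.0#
    ⊙-distribˡ  : ∀ x y z → x ⊙ (y ⊕ z) ∼ x ⊙ y ⊕ x ⊙ z
    con-+       : ∀ a b → con (a R.+ b) ∼ con a ⊕ con b
    con-*       : ∀ a b → con (a R.* b) ∼ con a ⊙ con b
    ι-+         : ∀ u v → ι (u M.+ᴹ v) ∼ ι u ⊕ ι v
    ι-*         : ∀ a v → ι (a M.*ₗ v) ∼ con a ⊙ ι v

  private
    ⊙-distribʳ : ∀ x y z → (y ⊕ z) ⊙ x ∼ y ⊙ x ⊕ z ⊙ x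
    ⊙-distribʳ x y z = ∼-trans (⊙-comm (y ⊕ z) x)
      (∼-trans (⊙-distribˡ x y z) (⊕-cong (⊙-comm x y) (⊙-comm x z)))

    inverseˡ : ∀ x → con (R.- R.1#) ⊙ x ⊕ x ∼ con R.0#
    inverseˡ x =
      ∼-trans (⊕-cong ∼-refl (∼-sym (⊙-identityˡ x)))
      (∼-trans (∼-sym (⊙-distribʳ x (con (R.- R.1#)) (con R.1#)))
      (∼-trans (⊙-cong (∼-sym (con-+ (R.- R.1#) R.1#)) ∼-refl)
      (∼-trans (⊙-cong (con-cong (R.-‿inverseˡ R.1#)) ∼-refl)
      (⊙-zeroˡ x))))

  symModule : Module R (c ⊔ m) (c ⊔ ℓ ⊔ m ⊔ ℓm)
  symModule = record
    { Carrierᴹ = Sym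
    ; _≈ᴹ_     = _∼_
    ; _+ᴹ_     = _⊕_
    ; _*ₗ_     = λ a x → con a ⊙ x
    ; _*ᵣ_     = λ x a → con a ⊙ x
    ; 0ᴹ       = con R.0#
    ; -ᴹ_      = con (R.- R.1#) ⊙_
    ; isModule = IsModuleFromLeft.isModule {commutativeRing = R} record
      { isLeftModule = record
        { isLeftSemimodule = record
          { +ᴹ-isCommutativeMonoid = record
            { isMonoid = record
              { isSemigroup = record
                { isMagma = record
                  { isEquivalence = record
                    { refl = ∼-refl ; sym = ∼-sym ; trans = ∼-trans }
                  ; ∙-cong = ⊕-cong
                  }
                ; assoc = ⊕-assoc
                }
              ; identity = ⊕-identityˡ
                         , λ x → ∼-trans (⊕-comm x (con R.0#)) (⊕-identityˡ x)
              }
            ; comm = ⊕-comm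
            }
          ; isPreleftSemimodule = record
            { *ₗ-cong      = λ a≈b x∼y → ⊙-cong (con-cong a≈b) x∼y
            ; *ₗ-zeroˡ     = ⊙-zeroˡ
            ; *ₗ-distribʳ  = λ x a b → ∼-trans (⊙-cong (con-+ a b) ∼-refl)
                                         (⊙-distribʳ x (con a) (con b))
            ; *ₗ-identityˡ = ⊙-identityˡ
            ; *ₗ-assoc     = λ a b x → ∼-trans (⊙-cong (con-* a b) ∼-refl)
                                         (⊙-assoc (con a) (con b) x)
            ; *ₗ-zeroʳ     = λ a → ∼-trans (⊙-comm (con a) (con R.0#)) (⊙-zeroˡ (con a))
            ; *ₗ-distribˡ  = λ a x y → ⊙-distribˡ (con a) x y
            }
          }
        ; -ᴹ‿cong = ⊙-cong ∼-refl
        ; -ᴹ‿inverse = inverseˡ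
                     , λ x → ∼-trans (⊕-comm x (con (R.- R.1#) ⊙ x)) (inverseˡ x)
        }
      }
    }

module EdgeColoring {c ℓ : Level} (R : CommutativeRing c ℓ) where

  open CommutativeRing R hiding (zero; refl; sym; trans)
  open RawMonoidDefs +-rawMonoid using (sum) renaming (_×_ to _·_)
  open RawMonoidDefs *-rawMonoid using () renaming (sum to product)
  open RawSemiringDefs (Semiring.rawSemiring semiring) using (_^_)

  kronecker : ∀ {n} → Fin n → Fin n → Carrier
  kronecker i j with i Fin.≟ j
  ... | yes _ = 1#
  ... | no  _ = 0#

  V : ℕ → Module R c ℓ
  V k = record
    { Carrierᴹ = Vector Carrier k
    ; _≈ᴹ_     = λ u v → ∀ i → u i ≈ v i
    ; _+ᴹ_     = λ u v i → u i + v i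
    ; _*ₗ_     = λ a v i → a * v i
    ; _*ᵣ_     = λ v a i → a * v i
    ; 0ᴹ       = λ _ → 0#
    ; -ᴹ_      = λ v i → - v i
    ; isModule = IsModuleFromLeft.isModule {commutativeRing = R} record
      { isLeftModule = record
        { isLeftSemimodule = record
          { +ᴹ-isCommutativeMonoid = record
            { isMonoid = record
              { isSemigroup = record
                { isMagma = record
                  { isEquivalence = record
                    { refl  = λ _ → CommutativeRing.refl R
                    ; sym   = λ p i → CommutativeRing.sym R (p i)
                    ; trans = λ p q i → CommutativeRing.trans R (p i) (q i)
                    }
                  ; ∙-cong = λ p q i → +-cong (p i) (q i)
                  }
                ; assoc = λ u v w i → +-assoc (u i) (v i) (w i)
                }
              ; identity = (λ v i → +-identityˡ (v i)) , (λ v i → +-identityʳ (v i))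
              }
            ; comm = λ u v i → +-comm (u i) (v i)
            }
          ; isPreleftSemimodule = record
            { *ₗ-cong      = λ a≈b p i → *-cong a≈b (p i)
            ; *ₗ-zeroˡ     = λ v i → zeroˡ (v i)
            ; *ₗ-distribʳ  = λ v a b i → distribʳ (v i) a b
            ; *ₗ-identityˡ = λ v i → *-identityˡ (v i)
            ; *ₗ-assoc     = λ a b v i → *-assoc a b (v i)
            ; *ₗ-zeroʳ     = λ a i → zeroʳ a
            ; *ₗ-distribˡ  = λ a u v i → distribˡ a (u i) (v i)
            }
          }
        ; -ᴹ‿cong    = λ p i → -‿cong (p i)
        ; -ᴹ‿inverse = (λ v i → -‿inverseˡ (v i)) , (λ v i → -‿inverseʳ (v i))
        }
      }
    }

  record Dual {m ℓm} (M : Module R m ℓm) : Set (c ⊔ ℓ ⊔ m ⊔ ℓm) where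
    private module M = Module M
    open ModuleMorphisms M.rawModule (Module.rawModule (TensorUnit.⟨module⟩ {R = R}))
    field
      ⟦_⟧      : M.Carrierᴹ → Carrier
      isLinear : IsModuleHomomorphism ⟦_⟧

  open Dual public using (⟦_⟧; isLinear)

  EdgeColoringModel : ℕ → Set (c ⊔ ℓ)
  EdgeColoringModel k = Dual (symModule (V k))

  e : ∀ {k} → Fin k → Sym (V k)
  e i = ι (kronecker i)

  ⨀ : ∀ {k} → List (Sym (V k)) → Sym (V k)
  ⨀ = foldr _⊙_ (con 1#)

  -- The sum of f φ over all maps φ : Fin m → Fin k, by choosing φ 0, φ 1, …
  -- in turn.
  sumMaps : ∀ m {k} → ((Fin m → Fin k) → Carrier) → Carrier
  sumMaps zero    f = f Vector.[]
  sumMaps (suc m) f = sum λ i → sumMaps m λ φ → f (i Vector.∷ φ)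

  partitionFunction : ∀ {k} → EdgeColoringModel k → Graph → Carrier
  partitionFunction h G =
    sumMaps ∣E∣ λ φ → product λ v → ⟦ h ⟧ (⨀ (map (λ a → e (φ a)) (δ v)))
    where open Graph G

  -- Laplace expansion along the first row.
  det : ∀ {n} → (Fin n → Fin n → Carrier) → Carrier
  det {zero}  A = 1#
  det {suc n} A = sum λ j →
    (- 1#) ^ toℕ j * A zero j * det (λ i l → A (suc i) (punchIn j l))

  -- The characteristic polynomial evaluated at t: the entries of tI − A
  -- are taken in R rather than in R[t].
  charPoly : Graph → Carrier → Carrier
  charPoly G t = det λ i j → t * kronecker i j - adjacency i j · 1#
    where open Graph G

open EdgeColoring ℂ-commutativeRing public

{-# OPTIONS --safe #-}

module Submission where

-- For M p q = h (e_p ⊙ e_q) the partition function of the n-cycle is tr Mⁿ,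
-- whereas det (−A) of the n-cycle, n ≥ 3, is −2, −4 or 0, and −2 for n = 3.
-- For a k × k matrix N the antisymmetrizer on k + 1 tensor factors gives
-- Σ_π sgn π ∏ tr N^(cycle length) = 0, π ranging over permutations of k + 1
-- points.  But sgn π is the product of −(−1)^length over the cycles of π, so
-- with N = −M³ the summand of π is the product of the numbers
-- −tr M^(3 length): all summands are nonnegative, and that of the identity is
-- positive.

open import Algebra.Bundles using (CommutativeMonoid; CommutativeRing; Semiring)
import Algebra.Definitions.RawMonoid as RawMonoidDefs
import Algebra.Definitions.RawSemiring as RawSemiringDefs
open import Algebra.Module.Morphism.Structures using (module ModuleMorphisms)
open import Data.Bool.Base using (Bool; true; false; if_then_else_; _∨_)
import Data.Bool.Properties as Bool
open import Data.Fin.Base using (Fin; zero; suc; toℕ; fromℕ; inject₁; punchIn; punchOut)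
import Data.Fin.Permutation as Perm
import Data.Fin.Permutation.Components as PC
open import Data.Fin.Properties
  using (_≟_; suc-injective; pigeonhole; <⇒≢; punchIn-punchOut; toℕ-inject₁; toℕ-fromℕ)
open import Data.List.Base as List using (List; []; _∷_; concatMap; filter; length; tabulate)
import Data.List.Properties as List
import Data.List.Relation.Unary.All.Properties as All
open import Data.Nat.Base as ℕ using (ℕ; zero; suc)
import Data.Nat.Properties as ℕ
open import Data.Product.Base using (∃; _×_; _,_; proj₁; proj₂; Σ-syntax)
open import Data.Rational.Base as ℚ using (0ℚ; 1ℚ)
import Data.Rational.Properties as ℚ
open import Data.Sum.Base using (inj₁; inj₂)
open import Data.Vec.Functional as Vector using (updateAt)
open import Data.Vec.Functional.Properties using (updateAt-updates; updateAt-minimal)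
open import Defs using (module EdgeColoring; Graph; Sym; _∼_; module _∼_; con; _⊙_)
open import Function.Base using (const; id; _∘_)
open import Relation.Binary.PropositionalEquality as ≡ using (_≡_; _≢_; _≗_)
open import Relation.Nullary.Decidable using (yes; no; does)
open import Relation.Nullary.Negation using (¬_; contradiction)
open import Relation.Unary using (Pred; Decidable)

-- Working with eigenvalues of M would require roots of polynomials in ℂ. The argument uses ring
-- identities instead, over an arbitrary commutative ring, and ℂ enters only through the fact that
-- no positive multiple of 1 is 0. Such a ring carries no order, so "nonnegative" means being a
-- natural multiple of 1. The sum over permutations is never written down: it is replaced by the
-- sum, over all maps φ from k + 1 points to k colours, of a determinant with columns φ, which
-- vanishes up to a factor 2 by the pigeonhole principle. Expanding that determinant along its first
-- row removes one point from its cycle, and this recursion carries the positivity. The cube is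
-- there because cycles on one or two vertices have a loop or a double edge, whereas the trace of
-- every positive power of M³ belongs to a simple cycle.

-- Sums with one nonzero term, and maps changed at one or two points.

module SumSingle {c ℓ} (M : CommutativeMonoid c ℓ) where
  open CommutativeMonoid M
  open import Algebra.Properties.CommutativeMonoid.Sum M

  sum-zero : ∀ {n} (f : Fin n → Carrier) → (∀ i → f i ≈ ε) → sum f ≈ ε
  sum-zero {n} f f≈0 = trans (sum-cong-≋ {n} f≈0) (sum-replicate-zero n)

  sum-single : ∀ {n} (f : Fin n → Carrier) i → (∀ j → j ≢ i → f j ≈ ε) → sum f ≈ f i
  sum-single f zero    f≈0 =
    trans (∙-congˡ (sum-zero _ (λ j → f≈0 (suc j) λ ()))) (identityʳ _)
  sum-single f (suc i) f≈0 =
    trans (∙-cong (f≈0 zero λ ())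
                  (sum-single (f ∘ suc) i λ j j≢i → f≈0 (suc j) (j≢i ∘ suc-injective)))
          (identityˡ _)

infixl 9 _[_≔_]
_[_≔_] : ∀ {a} {A : Set a} {n} → (Fin n → A) → Fin n → A → Fin n → A
f [ i ≔ x ] = updateAt f i (const x)

updateAt-same : ∀ {a} {A : Set a} {n} (f : Fin n → A) i {x} → (f [ i ≔ x ]) i ≡ x
updateAt-same f i = updateAt-updates i f

updateAt-other : ∀ {a} {A : Set a} {n} (f : Fin n → A) {i j} {x} → j ≢ i → (f [ i ≔ x ]) j ≡ f j
updateAt-other f {i} {j} j≢i = updateAt-minimal j i f j≢i

updateAt-cong : ∀ {a} {A : Set a} {n} {f g : Fin n → A} i {x} → f ≗ g → f [ i ≔ x ] ≗ g [ i ≔ x ]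
updateAt-cong zero    f≗g zero    = ≡.refl
updateAt-cong zero    f≗g (suc j) = f≗g (suc j)
updateAt-cong (suc i) f≗g zero    = f≗g zero
updateAt-cong (suc i) f≗g (suc j) = updateAt-cong i (f≗g ∘ suc) j

-- A relation between values rather than composition with a transposition: it needs no function
-- extensionality, and a map with equal values at i and j is `Swapped` with itself.
record Swapped {a} {A : Set a} {n} (i j : Fin n) (φ ψ : Fin n → A) : Set a where
  field
    distinct : i ≢ j
    atˡ      : ψ i ≡ φ j
    atʳ      : ψ j ≡ φ i
    others   : ∀ l → l ≢ i → l ≢ j → ψ l ≡ φ l
open Swapped

module _ {a} {A : Set a} where

  Swapped-flip : ∀ {n} {i j : Fin n} {φ ψ : Fin n → A} → Swapped i j φ ψ → Swapped j i φ ψ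
  Swapped-flip s = record
    { distinct = distinct s ∘ ≡.sym
    ; atˡ      = atʳ s
    ; atʳ      = atˡ s
    ; others   = λ l l≢j l≢i → others s l l≢i l≢j
    }

  Swapped-tail : ∀ {n} {i j : Fin n} {φ ψ : Fin (suc n) → A} →
                 Swapped (suc i) (suc j) φ ψ → Swapped i j (φ ∘ suc) (ψ ∘ suc)
  Swapped-tail s = record
    { distinct = distinct s ∘ ≡.cong suc
    ; atˡ      = atˡ s
    ; atʳ      = atʳ s
    ; others   = λ l l≢i l≢j →
        others s (suc l) (l≢i ∘ suc-injective) (l≢j ∘ suc-injective)
    }

  Swapped-update : ∀ {n} {i j l : Fin n} {φ ψ : Fin n → A} {q} → l ≢ i → l ≢ j →
                   Swapped i j φ ψ → Swapped i j (φ [ l ≔ q ]) (ψ [ l ≔ q ])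
  Swapped-update {l = l} {φ} {ψ} {q} l≢i l≢j s = record
    { distinct = distinct s
    ; atˡ      = keep (atˡ s) (l≢i ∘ ≡.sym) (l≢j ∘ ≡.sym)
    ; atʳ      = keep (atʳ s) (l≢j ∘ ≡.sym) (l≢i ∘ ≡.sym)
    ; others   = λ m m≢i m≢j → step m m≢i m≢j
    }
    where
    keep : ∀ {x y} → ψ x ≡ φ y → x ≢ l → y ≢ l → (ψ [ l ≔ q ]) x ≡ (φ [ l ≔ q ]) y
    keep eq x≢l y≢l =
      ≡.trans (updateAt-other ψ x≢l) (≡.trans eq (≡.sym (updateAt-other φ y≢l)))
    step : ∀ m → _ → _ → (ψ [ l ≔ q ]) m ≡ (φ [ l ≔ q ]) m
    step m m≢i m≢j with m ≟ l
    ... | yes ≡.refl = ≡.trans (updateAt-same ψ l) (≡.sym (updateAt-same φ l))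
    ... | no  m≢l    = keep (others s m m≢i m≢j) m≢l m≢l

  -- Needed when the column moved by the first-row expansion lands on one of the two swapped
  -- positions: replacement at i on one side corresponds to replacement at j on the other.
  Swapped-cross : ∀ {n} {i j : Fin n} {φ ψ : Fin n → A} {q} →
                  Swapped i j φ ψ → Swapped i j (φ [ i ≔ q ]) (ψ [ j ≔ q ])
  Swapped-cross {i = i} {j} {φ} {ψ} {q} s = record
    { distinct = distinct s
    ; atˡ      = ≡.trans (updateAt-other ψ (distinct s))
                   (≡.trans (atˡ s) (≡.sym (updateAt-other φ (distinct s ∘ ≡.sym))))
    ; atʳ      = ≡.trans (updateAt-same ψ j) (≡.sym (updateAt-same φ i))
    ; others   = λ m m≢i m≢j →
        ≡.trans (updateAt-other ψ m≢j)
          (≡.trans (others s m m≢i m≢j) (≡.sym (updateAt-other φ m≢i)))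
    }

-- Determinants as alternating functions of columns and linear functions of rows.

module Alternating {c ℓ} (R : CommutativeRing c ℓ) where
  open CommutativeRing R hiding (zero)
  open import Algebra.Properties.Ring ring using (-‿distribˡ-*; -‿distribʳ-*)
  open import Algebra.Properties.CommutativeSemigroup *-commutativeSemigroup using (x∙yz≈y∙xz)
  open import Algebra.Properties.Semiring.Sum semiring
  open SumSingle +-commutativeMonoid
  open import Relation.Binary.Reasoning.Setoid setoid
  open import Algebra.Solver.Ring.NaturalCoefficients.Default commutativeSemiring
    using (solve; _:+_; _:*_; _:=_)

  sum-cancel : ∀ {n} (f g : Fin n → Carrier) (π : Perm.Permutation n n) →
               (∀ l → f l + g (π Perm.⟨$⟩ʳ l) ≈ 0#) → sum f + sum g ≈ 0#
  sum-cancel f g π eq = begin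
    sum f + sum g                          ≈⟨ +-congˡ (sum-permute g π) ⟩
    sum f + sum (λ l → g (π Perm.⟨$⟩ʳ l))  ≈⟨ ∑-distrib-+ f _ ⟨
    sum (λ l → f l + g (π Perm.⟨$⟩ʳ l))    ≈⟨ sum-zero _ eq ⟩
    0#                                     ∎

  factor-zero : ∀ a {x y} → x + y ≈ 0# → a * x + a * y ≈ 0#
  factor-zero a eq = trans (sym (distribˡ a _ _)) (trans (*-congˡ eq) (zeroʳ a))

  combine : ∀ {n k} (c a : Fin k → Carrier) (b : Fin n → Fin k → Carrier) →
            sum (λ l → c l * a l) + sum (λ i → sum λ l → c l * b i l) ≈
            sum (λ l → c l * (a l + sum λ i → b i l))
  combine c a b = begin
    sum (λ l → c l * a l) + sum (λ i → sum λ l → c l * b i l)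
      ≈⟨ +-congˡ (∑-comm λ i l → c l * b i l) ⟩
    sum (λ l → c l * a l) + sum (λ l → sum λ i → c l * b i l)
      ≈⟨ ∑-distrib-+ (λ l → c l * a l) _ ⟨
    sum (λ l → c l * a l + sum λ i → c l * b i l)
      ≈⟨ sum-cong-≋ (λ l → trans (distribˡ (c l) _ _) (+-congˡ (*-distribˡ-sum (c l) λ i → b i l))) ⟨
    sum (λ l → c l * (a l + sum λ i → b i l)) ∎

  module _ {a} {A : Set a} where

    -- The determinant of the matrix (r i (φ j)), expanded along its first
    -- row.  Instead of deleting column j with a sign, column 0 is moved into
    -- its place.
    Δ : ∀ {n} → (Fin n → A → Carrier) → (Fin n → A) → Carrier
    Δ {zero}  r φ = 1#
    Δ {suc n} r φ =
      r zero (φ zero) * Δ (r ∘ suc) (φ ∘ suc) +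
      sum (λ j → - r zero (φ (suc j)) * Δ (r ∘ suc) ((φ ∘ suc) [ j ≔ φ zero ]))

    Δ-cong : ∀ {n} {r s : Fin n → A → Carrier} {φ ψ} → (∀ i x → r i x ≈ s i x) →
             φ ≗ ψ → Δ r φ ≈ Δ s ψ
    Δ-cong {zero}  r≈s φ≗ψ = refl
    Δ-cong {suc n} {r} {s} {φ} {ψ} r≈s φ≗ψ = +-cong
      (*-cong (entry zero) (Δ-cong (r≈s ∘ suc) (φ≗ψ ∘ suc)))
      (sum-cong-≋ λ j → *-cong (-‿cong (entry (suc j)))
        (Δ-cong (r≈s ∘ suc) λ l → moved j l))
      where
      entry : ∀ j → r zero (φ j) ≈ s zero (ψ j)
      entry j = trans (r≈s zero (φ j)) (reflexive (≡.cong (s zero) (φ≗ψ j)))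
      moved : ∀ j → (φ ∘ suc) [ j ≔ φ zero ] ≗ (ψ ∘ suc) [ j ≔ ψ zero ]
      moved j l = ≡.trans (updateAt-cong j (φ≗ψ ∘ suc) l)
        (≡.cong (λ x → ((ψ ∘ suc) [ j ≔ x ]) l) (φ≗ψ zero))

    Δ-congʳ : ∀ {n} (r : Fin n → A → Carrier) {φ ψ} → φ ≗ ψ → Δ r φ ≈ Δ r ψ
    Δ-congʳ r = Δ-cong {r = r} (λ _ _ → refl)

    -- Induction on the size. If position 0 is not involved, the leading terms cancel by induction,
    -- and the transposition of i and j matches the remaining terms of the two expansions in
    -- cancelling pairs.
    Δ-swap : ∀ {n} (r : Fin n → A → Carrier) {i j φ ψ} → Swapped i j φ ψ → Δ r φ + Δ r ψ ≈ 0#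
    -- The leading term of each expansion cancels the term at i of the other. For l other than i the
    -- two terms at l have equal first-row entries, and their smaller maps are swapped at l and i.
    Δ-swap-zero : ∀ {n} (r : Fin (suc n) → A → Carrier) {i φ ψ} →
                  Swapped zero (suc i) φ ψ → Δ r φ + Δ r ψ ≈ 0#
    Δ-swap {suc n} r {zero}  {zero}  s = contradiction ≡.refl (distinct s)
    Δ-swap {suc n} r {zero}  {suc j} s = Δ-swap-zero r s
    Δ-swap {suc n} r {suc i} {zero}  s = Δ-swap-zero r (Swapped-flip s)
    Δ-swap {suc n} r {suc i} {suc j} {φ} {ψ} s = begin
      (r₀ (φ zero) * Δ r′ φ′ + sum f) + (r₀ (ψ zero) * Δ r′ ψ′ + sum g)
        ≈⟨ solve 4 (λ a b c d → (a :+ b) :+ (c :+ d) := (a :+ c) :+ (b :+ d)) refl _ _ _ _ ⟩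
      (r₀ (φ zero) * Δ r′ φ′ + r₀ (ψ zero) * Δ r′ ψ′) + (sum f + sum g)
        ≈⟨ +-cong
             (trans (+-congˡ (*-congʳ (reflexive (≡.cong r₀ head≡))))
               (factor-zero _ (Δ-swap r′ (Swapped-tail s))))
             (sum-cancel f g (Perm.transpose i j) cancel) ⟩
      0# + 0#  ≈⟨ +-identityˡ 0# ⟩
      0#       ∎
      where
      r₀ = r zero
      r′ = r ∘ suc
      φ′ = φ ∘ suc
      ψ′ = ψ ∘ suc
      q = φ zero
      f g : Fin n → Carrier
      f l = - r₀ (φ′ l) * Δ r′ (φ′ [ l ≔ φ zero ])
      g l = - r₀ (ψ′ l) * Δ r′ (ψ′ [ l ≔ ψ zero ])
      head≡ : ψ zero ≡ φ zero
      head≡ = others s zero (λ ()) (λ ())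
      cancel-at : ∀ l m → ψ′ m ≡ φ′ l → Swapped i j (φ′ [ l ≔ q ]) (ψ′ [ m ≔ q ]) →
                  f l + g m ≈ 0#
      cancel-at l m eq t = begin
        f l + g m
          ≈⟨ +-congˡ (*-cong (-‿cong (reflexive (≡.cong r₀ eq)))
               (reflexive (≡.cong (λ x → Δ r′ (ψ′ [ m ≔ x ])) head≡))) ⟩
        - r₀ (φ′ l) * Δ r′ (φ′ [ l ≔ q ]) + - r₀ (φ′ l) * Δ r′ (ψ′ [ m ≔ q ])
          ≈⟨ factor-zero _ (Δ-swap r′ t) ⟩
        0# ∎
      s′ = Swapped-tail s
      cancel : ∀ l → f l + g (PC.transpose i j l) ≈ 0#
      cancel l with l ≟ i
      ... | yes ≡.refl = cancel-at i j (atʳ s′) (Swapped-cross s′)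
      ... | no  l≢i with l ≟ j
      ...   | yes ≡.refl =
                cancel-at j i (atˡ s′) (Swapped-flip (Swapped-cross (Swapped-flip s′)))
      ...   | no  l≢j =
                cancel-at l l (others s′ l l≢i l≢j) (Swapped-update l≢i l≢j s′)

    Δ-swap-zero {n} r {i} {φ} {ψ} s = begin
      (r₀ q * Δ r′ φ′ + sum f) + (r₀ (ψ zero) * Δ r′ ψ′ + sum g)
        ≈⟨ solve 4 (λ a b c d → (a :+ b) :+ (c :+ d) := (a :+ c) :+ (b :+ d)) refl _ _ _ _ ⟩
      (r₀ q * Δ r′ φ′ + r₀ (ψ zero) * Δ r′ ψ′) + (sum f + sum g)
        ≈⟨ +-congˡ (∑-distrib-+ f g) ⟨
      (r₀ q * Δ r′ φ′ + r₀ (ψ zero) * Δ r′ ψ′) + sum (λ l → f l + g l)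
        ≈⟨ +-congˡ (sum-single _ i off-diagonal) ⟩
      (r₀ q * Δ r′ φ′ + r₀ (ψ zero) * Δ r′ ψ′) + (f i + g i)
        ≈⟨ solve 4 (λ a b c d → (a :+ b) :+ (c :+ d) := (a :+ d) :+ (b :+ c)) refl _ _ _ _ ⟩
      (r₀ q * Δ r′ φ′ + g i) + (r₀ (ψ zero) * Δ r′ ψ′ + f i)
        ≈⟨ +-cong (cancel (atʳ s) φ′≗)
                  (cancel (≡.sym (atˡ s)) (λ l → ≡.sym (ψ′≗ l))) ⟩
      0# + 0#  ≈⟨ +-identityˡ 0# ⟩
      0#       ∎
      where
      r₀ = r zero
      r′ = r ∘ suc
      φ′ = φ ∘ suc
      ψ′ = ψ ∘ suc
      q = φ zero
      f g : Fin n → Carrier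
      f l = - r₀ (φ′ l) * Δ r′ (φ′ [ l ≔ φ zero ])
      g l = - r₀ (ψ′ l) * Δ r′ (ψ′ [ l ≔ ψ zero ])
      cancel : ∀ {x y χ ω} → x ≡ y → ω ≗ χ → r₀ y * Δ r′ χ + - r₀ x * Δ r′ ω ≈ 0#
      cancel {x} {y} {χ} {ω} eq ω≗χ = begin
        r₀ y * Δ r′ χ + - r₀ x * Δ r′ ω
          ≈⟨ +-congˡ (*-cong (-‿cong (reflexive (≡.cong r₀ eq))) (Δ-congʳ r′ ω≗χ)) ⟩
        r₀ y * Δ r′ χ + - r₀ y * Δ r′ χ  ≈⟨ distribʳ _ _ _ ⟨
        (r₀ y + - r₀ y) * Δ r′ χ         ≈⟨ *-congʳ (-‿inverseʳ _) ⟩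
        0# * Δ r′ χ                      ≈⟨ zeroˡ _ ⟩
        0#                               ∎
      elsewhere : ∀ l → l ≢ i → ψ′ l ≡ φ′ l
      elsewhere l l≢i = others s (suc l) (λ ()) (l≢i ∘ suc-injective)
      φ′≗ : ψ′ [ i ≔ ψ zero ] ≗ φ′
      φ′≗ l with l ≟ i
      ... | yes ≡.refl = ≡.trans (updateAt-same ψ′ i) (atˡ s)
      ... | no  l≢i    = ≡.trans (updateAt-other ψ′ l≢i) (elsewhere l l≢i)
      ψ′≗ : ψ′ ≗ φ′ [ i ≔ q ]
      ψ′≗ l with l ≟ i
      ... | yes ≡.refl = ≡.trans (atʳ s) (≡.sym (updateAt-same φ′ i))
      ... | no  l≢i    = ≡.trans (elsewhere l l≢i) (≡.sym (updateAt-other φ′ l≢i))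
      off-diagonal : ∀ l → l ≢ i → f l + g l ≈ 0#
      off-diagonal l l≢i = begin
        f l + g l
          ≈⟨ +-congˡ (*-congʳ (-‿cong (reflexive (≡.cong r₀ (elsewhere l l≢i))))) ⟩
        - r₀ (φ′ l) * Δ r′ (φ′ [ l ≔ φ zero ]) + - r₀ (φ′ l) * Δ r′ (ψ′ [ l ≔ ψ zero ])
          ≈⟨ factor-zero _ (Δ-swap r′ swapped) ⟩
        0# ∎
        where
        swapped : Swapped l i (φ′ [ l ≔ φ zero ]) (ψ′ [ l ≔ ψ zero ])
        swapped = record
          { distinct = l≢i
          ; atˡ      = ≡.trans (updateAt-same ψ′ l)
                         (≡.trans (atˡ s) (≡.sym (updateAt-other φ′ (l≢i ∘ ≡.sym))))
          ; atʳ      = ≡.trans (updateAt-other ψ′ (l≢i ∘ ≡.sym))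
                         (≡.trans (atʳ s) (≡.sym (updateAt-same φ′ l)))
          ; others   = λ m m≢l m≢i → ≡.trans (updateAt-other ψ′ m≢l)
                         (≡.trans (elsewhere m m≢i) (≡.sym (updateAt-other φ′ m≢l)))
          }

    -- Doubled, since swapping the two equal columns only gives Δ ≈ − Δ.
    Δ-repeated : ∀ {n} (r : Fin n → A → Carrier) {i j φ} → i ≢ j → φ i ≡ φ j →
                 Δ r φ + Δ r φ ≈ 0#
    Δ-repeated r i≢j eq = Δ-swap r record
      { distinct = i≢j ; atˡ = eq ; atʳ = ≡.sym eq ; others = λ _ _ _ → ≡.refl }

    Δ-linear : ∀ {n k} (r : Fin n → A → Carrier) j (c : Fin k → Carrier)
               (y : Fin k → A → Carrier) φ →
               Δ (r [ j ≔ (λ x → sum λ l → c l * y l x) ]) φ ≈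
               sum (λ l → c l * Δ (r [ j ≔ y l ]) φ)
    Δ-linear {suc n} {k} r zero c y φ = trans
      (+-cong (pull _ _) (sum-cong-≋ {n} λ j → pull-neg _ _))
      (combine {n} {k} c _ λ j l → - y l (φ (suc j)) * _)
      where
      pull : ∀ x d → sum (λ l → c l * y l x) * d ≈ sum (λ l → c l * (y l x * d))
      pull x d = trans (*-distribʳ-sum {k} d _) (sum-cong-≋ {k} λ l → *-assoc _ _ _)
      move-neg : ∀ a b → - a * b ≈ a * - b
      move-neg a b = trans (sym (-‿distribˡ-* a b)) (-‿distribʳ-* a b)
      pull-neg : ∀ x d → - sum (λ l → c l * y l x) * d ≈ sum (λ l → c l * (- y l x * d))
      pull-neg x d = begin
        - sum (λ l → c l * y l x) * d       ≈⟨ move-neg _ _ ⟩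
        sum (λ l → c l * y l x) * - d       ≈⟨ pull x (- d) ⟩
        sum (λ l → c l * (y l x * - d))     ≈⟨ sum-cong-≋ {k} (λ l → *-congˡ (move-neg _ _)) ⟨
        sum (λ l → c l * (- y l x * d))     ∎
    Δ-linear {suc n} {k} r (suc j) c y φ = trans
      (+-cong (pull (r zero (φ zero)) (Δ-linear (r ∘ suc) j c y _))
              (sum-cong-≋ {n} λ i → pull (- r zero (φ (suc i))) (Δ-linear (r ∘ suc) j c y _)))
      (combine {n} {k} c _ λ i l → - r zero (φ (suc i)) * _)
      where
      pull : ∀ a {x} {f : Fin k → Carrier} → x ≈ sum (λ l → c l * f l) →
             a * x ≈ sum (λ l → c l * (a * f l))
      pull a {x} {f} eq = begin
        a * x                        ≈⟨ *-congˡ eq ⟩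
        a * sum (λ l → c l * f l)    ≈⟨ *-distribˡ-sum {k} a _ ⟩
        sum (λ l → a * (c l * f l))  ≈⟨ sum-cong-≋ {k} (λ l → x∙yz≈y∙xz a (c l) (f l)) ⟩
        sum (λ l → c l * (a * f l))  ∎

-- Sums over all maps between finite sets.

module Maps {c ℓ} (R : CommutativeRing c ℓ) where
  open CommutativeRing R hiding (zero)
  open EdgeColoring R using (sumMaps)
  open SumSingle +-commutativeMonoid
  open import Algebra.Properties.Semiring.Sum semiring
  open import Relation.Binary.Reasoning.Setoid setoid

  sumMaps-cong : ∀ m {k} {f g : (Fin m → Fin k) → Carrier} → (∀ φ → f φ ≈ g φ) →
                 sumMaps m f ≈ sumMaps m g
  sumMaps-cong zero        f≈g = f≈g Vector.[]
  sumMaps-cong (suc m) {k} f≈g = sum-cong-≋ {k} λ i → sumMaps-cong m λ φ → f≈g (i Vector.∷ φ)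

  sumMaps-+ : ∀ m {k} (f g : (Fin m → Fin k) → Carrier) →
              sumMaps m (λ φ → f φ + g φ) ≈ sumMaps m f + sumMaps m g
  sumMaps-+ zero    f g     = refl
  sumMaps-+ (suc m) {k} f g = trans
    (sum-cong-≋ {k} λ i → sumMaps-+ m (λ φ → f (i Vector.∷ φ)) (λ φ → g (i Vector.∷ φ)))
    (∑-distrib-+ {k} _ _)

  sumMaps-*ˡ : ∀ m {k} a (f : (Fin m → Fin k) → Carrier) →
               a * sumMaps m f ≈ sumMaps m (λ φ → a * f φ)
  sumMaps-*ˡ zero    a f     = refl
  sumMaps-*ˡ (suc m) {k} a f = trans (*-distribˡ-sum {k} a _)
    (sum-cong-≋ {k} λ i → sumMaps-*ˡ m a (λ φ → f (i Vector.∷ φ)))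

  sumMaps-sum : ∀ m {k n} (f : Fin n → (Fin m → Fin k) → Carrier) →
                sumMaps m (λ φ → sum λ j → f j φ) ≈ sum λ j → sumMaps m (f j)
  sumMaps-sum zero        f = refl
  sumMaps-sum (suc m) {k} {n} f = trans
    (sum-cong-≋ {k} λ i → sumMaps-sum m λ j φ → f j (i Vector.∷ φ))
    (∑-comm {k} {n} _)

  sumMaps-zero : ∀ m {k} {f : (Fin m → Fin k) → Carrier} → (∀ φ → f φ ≈ 0#) →
                 sumMaps m f ≈ 0#
  sumMaps-zero zero        f≈0 = f≈0 Vector.[]
  sumMaps-zero (suc m) {k} f≈0 = sum-zero {k} _ λ i → sumMaps-zero m λ φ → f≈0 (i Vector.∷ φ)

  -- Sending the pair (q, φ) to (φ j, φ [ j ≔ q ]) is an involution, so both sides have the same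
  -- summands.
  sumMaps-exchange : ∀ n {k} (H : Fin k → (Fin n → Fin k) → Carrier) →
    (∀ l {φ ψ} → φ ≗ ψ → H l φ ≈ H l ψ) → ∀ j →
    sum (λ q → sumMaps n λ φ → H (φ j) (φ [ j ≔ q ])) ≈
    sumMaps n λ φ → sum λ l → H l φ
  sumMaps-exchange (suc n) {k} H H-cong zero = sum-cong-≋ {k} λ q → begin
    sum (λ a → sumMaps n λ φ → H a ((a Vector.∷ φ) [ zero ≔ q ]))
      ≈⟨ sum-cong-≋ {k} (λ a → sumMaps-cong n λ φ → H-cong a
           λ { zero → ≡.refl ; (suc _) → ≡.refl }) ⟩
    sum (λ a → sumMaps n λ φ → H a (q Vector.∷ φ))
      ≈⟨ sumMaps-sum n (λ a φ → H a (q Vector.∷ φ)) ⟨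
    sumMaps n (λ φ → sum λ a → H a (q Vector.∷ φ)) ∎
  sumMaps-exchange (suc n) {k} H H-cong (suc j) = begin
    sum (λ q → sum λ a → sumMaps n λ φ → H (φ j) ((a Vector.∷ φ) [ suc j ≔ q ]))
      ≈⟨ ∑-comm {k} {k} _ ⟩
    sum (λ a → sum λ q → sumMaps n λ φ → H (φ j) ((a Vector.∷ φ) [ suc j ≔ q ]))
      ≈⟨ sum-cong-≋ {k} (λ a → trans
           (sum-cong-≋ {k} λ q → sumMaps-cong n λ φ → H-cong (φ j)
             λ { zero → ≡.refl ; (suc _) → ≡.refl })
           (sumMaps-exchange n (λ l φ → H l (a Vector.∷ φ))
             (λ l φ≗ψ → H-cong l λ { zero → ≡.refl ; (suc i) → φ≗ψ i }) j)) ⟩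
    sum (λ a → sumMaps n λ φ → sum λ l → H l (a Vector.∷ φ)) ∎

-- The trace identity and its positivity.

module TraceIdentity {c ℓ} (R : CommutativeRing c ℓ) where
  open CommutativeRing R hiding (zero)
  open EdgeColoring R using (sumMaps)
  open Alternating R
  open Maps R
  open import Algebra.Properties.Semiring.Sum semiring
  open import Algebra.Properties.Semiring.Mult semiring
    using (×-homo-+; ×1-homo-*) renaming (_×_ to _·_)
  open import Relation.Binary.Reasoning.Setoid setoid

  -- Substitutes for x ≥ 0 and x > 0 in a ring without an order.
  IsNat IsPos : Carrier → Set ℓ
  IsNat x = ∃ λ n → x ≈ n · 1#
  IsPos x = ∃ λ n → x ≈ suc n · 1#

  pos⇒nat : ∀ {x} → IsPos x → IsNat x
  pos⇒nat (n , eq) = suc n , eq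

  nat-+ : ∀ {x y} → IsNat x → IsNat y → IsNat (x + y)
  nat-+ (m , p) (n , q) = m ℕ.+ n , trans (+-cong p q) (sym (×-homo-+ 1# m n))

  nat-* : ∀ {x y} → IsNat x → IsNat y → IsNat (x * y)
  nat-* (m , p) (n , q) = m ℕ.* n , trans (*-cong p q) (sym (×1-homo-* m n))

  nat-sum : ∀ {n} {f : Fin n → Carrier} → (∀ i → IsNat (f i)) → IsNat (sum f)
  nat-sum {zero}  p = 0 , refl
  nat-sum {suc n} p = nat-+ (p zero) (nat-sum (p ∘ suc))

  pos-+ : ∀ {x y} → IsPos x → IsNat y → IsPos (x + y)
  pos-+ (m , p) (n , q) = m ℕ.+ n , trans (+-cong p q) (sym (×-homo-+ 1# (suc m) n))

  pos-* : ∀ {x y} → IsPos x → IsPos y → IsPos (x * y)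
  pos-* (m , p) (n , q) = n ℕ.+ m ℕ.* suc n , trans (*-cong p q) (sym (×1-homo-* (suc m) (suc n)))

  nat-resp : ∀ {x y} → x ≈ y → IsNat y → IsNat x
  nat-resp x≈y (n , eq) = n , trans x≈y eq

  pos-resp : ∀ {x y} → x ≈ y → IsPos y → IsPos x
  pos-resp x≈y (n , eq) = n , trans x≈y eq

  -- The family `Y` is closed under (X, Z) ↦ -XZ. This minus sign is the one that the expansion of
  -- `Δ` attaches to moving a column, so that `minors-step` has plus signs only.
  module _ {k} {i} {I : Set i} (_⊕_ : I → I → I) (Y : I → Fin k → Fin k → Carrier)
    (Y-⊕ : ∀ a b p q → sum (λ l → - Y a p l * Y b l q) ≈ Y (a ⊕ b) p q)
    where

    trace : I → Carrier
    trace a = sum λ q → Y a q q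

    -- This is the trace, on n tensor factors, of the product of the matrices `Y (x i)` with the
    -- unnormalised antisymmetrizer Σ sgn(π) π. For constant x over a field of characteristic zero
    -- it is n! times the sum of the principal minors of size n.
    minors : ∀ {n} → (Fin n → I) → Carrier
    minors {n} x = sumMaps n λ φ → Δ (λ i → Y (x i) (φ i)) φ

    -- In terms of permutations, point 0 is either fixed and splits off a trace, or is spliced out
    -- of its cycle, its matrix being multiplied into that of a neighbouring point j.
    minors-step : ∀ {n} (x : Fin (suc n) → I) →
      minors x ≈ trace (x zero) * minors (x ∘ suc) +
                 sum λ j → minors ((x ∘ suc) [ j ≔ x zero ⊕ x (suc j) ])
    minors-step {n} x = begin
      sum (λ q → sumMaps n λ φ →
        Y₀ q q * Δ (rows φ) φ + sum λ j → - Y₀ q (φ j) * Δ (rows φ) (φ [ j ≔ q ]))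
        ≈⟨ sum-cong-≋ {k} (λ q → trans
             (sumMaps-+ n (λ φ → Y₀ q q * Δ (rows φ) φ) _)
             (+-cong (sym (sumMaps-*ˡ n (Y₀ q q) (λ φ → Δ (rows φ) φ)))
                     (sumMaps-sum n (λ j φ → - Y₀ q (φ j) * Δ (rows φ) (φ [ j ≔ q ]))))) ⟩
      sum (λ q → Y₀ q q * minors x′ +
        sum λ j → sumMaps n λ φ → - Y₀ q (φ j) * Δ (rows φ) (φ [ j ≔ q ]))
        ≈⟨ ∑-distrib-+ {k} _ _ ⟩
      sum (λ q → Y₀ q q * minors x′) +
      sum (λ q → sum λ j → sumMaps n λ φ → - Y₀ q (φ j) * Δ (rows φ) (φ [ j ≔ q ]))
        ≈⟨ +-cong (sym (*-distribʳ-sum {k} (minors x′) _)) (∑-comm {k} {n} _) ⟩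
      trace (x zero) * minors x′ +
      sum (λ j → sum λ q → sumMaps n λ φ → - Y₀ q (φ j) * Δ (rows φ) (φ [ j ≔ q ]))
        ≈⟨ +-congˡ (sum-cong-≋ {n} contract) ⟩
      trace (x zero) * minors x′ + sum (λ j → minors (x′ [ j ≔ x zero ⊕ x′ j ])) ∎
      where
      x′ = x ∘ suc
      Y₀ = Y (x zero)
      rows : (Fin n → Fin k) → Fin n → Fin k → Carrier
      rows φ i = Y (x (suc i)) (φ i)

      module _ (j : Fin n) where
        H : Fin k → (Fin n → Fin k) → Carrier
        H l φ = - Y₀ (φ j) l * Δ (rows φ [ j ≔ Y (x′ j) l ]) φ

        H-cong : ∀ l {φ ψ} → φ ≗ ψ → H l φ ≈ H l ψ
        H-cong l {φ} {ψ} φ≗ψ = *-cong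
          (-‿cong (reflexive (≡.cong (λ p → Y₀ p l) (φ≗ψ j))))
          (Δ-cong {r = rows φ [ j ≔ Y (x′ j) l ]} row φ≗ψ)
          where
          row : ∀ i z → (rows φ [ j ≔ Y (x′ j) l ]) i z ≈ (rows ψ [ j ≔ Y (x′ j) l ]) i z
          row i z with i ≟ j
          ... | yes ≡.refl = reflexive (≡.cong-app
                  (≡.trans (updateAt-same (rows φ) j) (≡.sym (updateAt-same (rows ψ) j))) z)
          ... | no  i≢j    = reflexive (≡.cong-app (≡.trans (updateAt-other (rows φ) i≢j)
                  (≡.trans (≡.cong (Y (x′ i)) (φ≗ψ i)) (≡.sym (updateAt-other (rows ψ) i≢j)))) z)

        -- Renames the map φ [ j ≔ q ] to φ and the old value φ j to l.
        rename : ∀ q φ → - Y₀ q (φ j) * Δ (rows φ) (φ [ j ≔ q ]) ≈ H (φ j) (φ [ j ≔ q ])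
        rename q φ = *-cong
          (-‿cong (reflexive (≡.cong (λ p → Y₀ p (φ j)) (≡.sym (updateAt-same φ j)))))
          (Δ-cong {r = rows φ} row (λ _ → ≡.refl))
          where
          row : ∀ i z → rows φ i z ≈ (rows (φ [ j ≔ q ]) [ j ≔ Y (x′ j) (φ j) ]) i z
          row i z with i ≟ j
          ... | yes ≡.refl = reflexive (≡.cong-app (≡.sym (updateAt-same (rows (φ [ j ≔ q ])) j)) z)
          ... | no  i≢j    = reflexive (≡.cong-app (≡.sym (≡.trans
                  (updateAt-other (rows (φ [ j ≔ q ])) i≢j)
                  (≡.cong (Y (x′ i)) (updateAt-other φ i≢j)))) z)

        product-row : ∀ φ i z →
          (rows φ [ j ≔ (λ z → sum λ l → - Y₀ (φ j) l * Y (x′ j) l z) ]) i z ≈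
          Y ((x′ [ j ≔ x zero ⊕ x′ j ]) i) (φ i) z
        product-row φ i z with i ≟ j
        ... | yes ≡.refl = trans (reflexive (≡.cong-app (updateAt-same (rows φ) j) z))
                (trans (Y-⊕ (x zero) (x′ j) (φ j) z)
                  (reflexive (≡.cong (λ a → Y a (φ j) z) (≡.sym (updateAt-same x′ j)))))
        ... | no  i≢j    = reflexive (≡.cong-app (≡.trans (updateAt-other (rows φ) i≢j)
                (≡.cong (λ a → Y a (φ i)) (≡.sym (updateAt-other x′ i≢j)))) z)

        -- Once the old value at j has become a free summation index l, linearity in row j gathers
        -- the sum over l into a row of the product -Y₀ Y (x′ j).
        contract :
          sum (λ q → sumMaps n λ φ → - Y₀ q (φ j) * Δ (rows φ) (φ [ j ≔ q ])) ≈
          minors (x′ [ j ≔ x zero ⊕ x′ j ])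
        contract = begin
          sum (λ q → sumMaps n λ φ → - Y₀ q (φ j) * Δ (rows φ) (φ [ j ≔ q ]))
            ≈⟨ sum-cong-≋ {k} (λ q → sumMaps-cong n (rename q)) ⟩
          sum (λ q → sumMaps n λ φ → H (φ j) (φ [ j ≔ q ]))
            ≈⟨ sumMaps-exchange n H H-cong j ⟩
          sumMaps n (λ φ → sum λ l → H l φ)
            ≈⟨ sumMaps-cong n (λ φ → trans
                 (sym (Δ-linear (rows φ) j (λ l → - Y₀ (φ j) l) (Y (x′ j)) φ))
                 (Δ-cong (product-row φ) (λ _ → ≡.refl))) ⟩
          minors (x′ [ j ≔ x zero ⊕ x′ j ]) ∎

    module _ (trace-nat : ∀ a → IsNat (trace a)) where

      -- Arbitrary x is essential to the induction: even from a constant family, one step produces a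
      -- family with an entry a ⊕ a.
      minors-nat : ∀ {n} (x : Fin n → I) → IsNat (minors x)
      minors-nat {zero}  x = 1 , sym (+-identityʳ 1#)
      minors-nat {suc n} x = nat-resp (minors-step x)
        (nat-+ (nat-* (trace-nat (x zero)) (minors-nat (x ∘ suc)))
               (nat-sum {n} λ j → minors-nat ((x ∘ suc) [ j ≔ x zero ⊕ x (suc j) ])))

      -- Following the first summand of `minors-step` throughout gives the power of the trace that
      -- belongs to the identity permutation; the other summands are natural.
      minors-pos : ∀ {a} → IsPos (trace a) → ∀ n → IsPos (minors {n} (const a))
      minors-pos a>0 zero    = 0 , sym (+-identityʳ 1#)
      minors-pos {a} a>0 (suc n) = pos-resp (minors-step {n} (const a))
        (pos-+ (pos-* a>0 (minors-pos a>0 n))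
               (nat-sum {n} λ j → minors-nat (const a [ j ≔ a ⊕ a ])))

    -- Among k + 1 points coloured with k colours two agree, so every determinant in the sum has two
    -- equal columns.
    minors-vanish : (x : Fin (suc k) → I) → minors x + minors x ≈ 0#
    minors-vanish x = trans (sym (sumMaps-+ (suc k) {k} Δx Δx))
      (sumMaps-zero (suc k) {k} λ φ →
        let i , j , i<j , eq = pigeonhole ℕ.≤-refl φ
        in Δ-repeated (λ i → Y (x i) (φ i)) {φ = φ} (<⇒≢ i<j) eq)
      where
      Δx : (Fin (suc k) → Fin k) → Carrier
      Δx φ = Δ (λ i → Y (x i) (φ i)) φ

    positive-trace-absurd : (∀ n → ¬ suc n · 1# ≈ 0#) → (∀ a → IsNat (trace a)) →
                            ∀ {a} → ¬ IsPos (trace a)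
    positive-trace-absurd char0 trace-nat {a} a>0 =
      let p = minors-pos trace-nat a>0 (suc k)
          n , eq = pos-+ p (pos⇒nat p)
      in char0 n (trans (sym eq) (minors-vanish (const a)))

-- Cyclic rotation and the cycle graphs.

snoc : ∀ {a} {A : Set a} {n} → (Fin n → A) → A → Fin (suc n) → A
snoc {n = zero}  f x _       = x
snoc {n = suc n} f x zero    = f zero
snoc {n = suc n} f x (suc i) = snoc (f ∘ suc) x i

snoc-map : ∀ {a b} {A : Set a} {B : Set b} {n} (g : A → B) (f : Fin n → A) x →
           g ∘ snoc f x ≗ snoc (g ∘ f) (g x)
snoc-map {n = zero}  g f x zero    = ≡.refl
snoc-map {n = suc n} g f x zero    = ≡.refl
snoc-map {n = suc n} g f x (suc i) = snoc-map g (f ∘ suc) x i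

snoc-last : ∀ {a} {A : Set a} {n} (f : Fin n → A) x → snoc f x (fromℕ n) ≡ x
snoc-last {n = zero}  f x = ≡.refl
snoc-last {n = suc n} f x = snoc-last (f ∘ suc) x

snoc-inject₁ : ∀ {a} {A : Set a} {n} (f : Fin n → A) x i → snoc f x (inject₁ i) ≡ f i
snoc-inject₁ {n = suc n} f x zero    = ≡.refl
snoc-inject₁ {n = suc n} f x (suc i) = snoc-inject₁ (f ∘ suc) x i

snoc-id : ∀ n → snoc inject₁ (fromℕ n) ≗ id
snoc-id zero    zero    = ≡.refl
snoc-id (suc n) zero    = ≡.refl
snoc-id (suc n) (suc i) =
  ≡.trans (≡.sym (snoc-map suc inject₁ (fromℕ n) i)) (≡.cong suc (snoc-id n i))

-- Defining `next` through `snoc` turns φ ∘ next into the list of later values of φ closed up by its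
-- first value, which is the form of a closed walk.
next prev : ∀ {n} → Fin (suc n) → Fin (suc n)
next = snoc suc zero
prev zero    = fromℕ _
prev (suc i) = inject₁ i

next-prev : ∀ {n} (i : Fin (suc n)) → next (prev i) ≡ i
next-prev zero    = snoc-last suc zero
next-prev (suc i) = snoc-inject₁ suc zero i

prev-next : ∀ {n} (i : Fin (suc n)) → prev (next i) ≡ i
prev-next {n} i = ≡.trans (snoc-map prev suc zero i) (snoc-id n i)

-- The index is one less than the length: `cycle 0` is a loop, `cycle 1` a double edge and `cycle 2`
-- the triangle.
cycle : ℕ → Graph
cycle n = record { ∣V∣ = suc n ; ∣E∣ = suc n ; ends = λ a → a , prev a }

-- The partition function of a cycle as a trace.

module Cycle {c ℓ} (R : CommutativeRing c ℓ) where
  open CommutativeRing R hiding (zero)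
  private module E = EdgeColoring R
  open E using (sumMaps; EdgeColoringModel; ⟦_⟧; isLinear; e; ⨀; partitionFunction)
  open RawMonoidDefs *-rawMonoid using () renaming (sum to product)
  open import Algebra.Properties.Monoid.Sum *-monoid using () renaming (sum-cong-≋ to product-cong)
  open Maps R
  open import Algebra.Properties.Semiring.Sum semiring
  open import Relation.Binary.Reasoning.Setoid setoid

  module _ (k : ℕ) where

    ⊙-commutativeMonoid : CommutativeMonoid _ _
    ⊙-commutativeMonoid = record
      { Carrier = Sym (E.V k)
      ; _≈_     = _∼_ (E.V k)
      ; _∙_     = _⊙_
      ; ε       = con 1#
      ; isCommutativeMonoid = record
        { isMonoid = record
          { isSemigroup = record
            { isMagma = record
              { isEquivalence = record
                { refl = _∼_.∼-refl ; sym = _∼_.∼-sym ; trans = _∼_.∼-trans }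
              ; ∙-cong = _∼_.⊙-cong
              }
            ; assoc = _∼_.⊙-assoc
            }
          ; identity = _∼_.⊙-identityˡ
                     , λ x → _∼_.∼-trans (_∼_.⊙-comm x (con 1#)) (_∼_.⊙-identityˡ x)
          }
        ; comm = _∼_.⊙-comm
        }
      }

  module _ {k : ℕ} where
    private module S = CommutativeMonoid (⊙-commutativeMonoid k)
    open import Algebra.Properties.CommutativeMonoid.Sum (⊙-commutativeMonoid k)
      using () renaming (sum to prod; ∑-distrib-+ to prod-⊙; sum-cong-≋ to prod-cong)
    open SumSingle (⊙-commutativeMonoid k) renaming (sum-single to prod-single)

    ⨀-++ : ∀ {a} {A : Set a} (g : A → Sym (E.V k)) xs ys →
           ⨀ (List.map g (xs List.++ ys)) S.≈ ⨀ (List.map g xs) ⊙ ⨀ (List.map g ys)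
    ⨀-++ g []       ys = S.sym (S.identityˡ _)
    ⨀-++ g (x ∷ xs) ys = S.trans (S.∙-congˡ (⨀-++ g xs ys)) (S.sym (S.assoc _ _ _))

    ⨀-concatMap : ∀ {a b} {A : Set a} {B : Set b} (g : B → Sym (E.V k)) (F : A → List B)
                  {n} (f : Fin n → A) →
                  ⨀ (List.map g (concatMap F (tabulate f))) S.≈
                  prod λ i → ⨀ (List.map g (F (f i)))
    ⨀-concatMap g F {zero}  f = S.refl
    ⨀-concatMap g F {suc n} f = S.trans (⨀-++ g (F (f zero)) _)
      (S.∙-congˡ (⨀-concatMap g F (f ∘ suc)))

    -- The product over δ v splits into the contribution of first ends equal to v, which only edge v
    -- has, and that of second ends, which only edge `next v` has. Counting ends rather than edges
    -- also covers the loop.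
    ⨀-δ : ∀ {n} (g : Fin (suc n) → Sym (E.V k)) v →
          ⨀ (List.map g (Graph.δ (cycle n) v)) S.≈ g v ⊙ g (next v)
    ⨀-δ {n} g v = S.trans (⨀-concatMap g ends-at {suc n} id) (S.trans (prod-cong {suc n} split)
      (S.trans (prod-⊙ at-v at-next)
        (S.∙-cong (S.trans (prod-single at-v v at-v-off) at-v-on)
                  (S.trans (prod-single at-next (next v) at-next-off) at-next-on))))
      where
      ends-at : Fin (suc n) → List (Fin (suc n))
      ends-at a = List.map (λ _ → a) (filter (_≟ v) (a ∷ prev a ∷ []))
      at-v at-next : Fin (suc n) → Sym (E.V k)
      at-v    a = if does (a ≟ v) then g a else con 1#
      at-next a = if does (prev a ≟ v) then g a else con 1#
      split : ∀ a → ⨀ (List.map g (ends-at a)) S.≈ at-v a ⊙ at-next a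
      split a with does (a ≟ v)
      split a | true with does (prev a ≟ v)
      ... | true  = S.∙-congˡ (S.identityʳ _)
      ... | false = S.refl
      split a | false with does (prev a ≟ v)
      ... | true  = S.trans (S.identityʳ _) (S.sym (S.identityˡ _))
      ... | false = S.sym (S.identityˡ _)
      at-v-on : at-v v S.≈ g v
      at-v-on with v ≟ v
      ... | yes _   = S.refl
      ... | no  v≢v = contradiction ≡.refl v≢v
      at-v-off : ∀ a → a ≢ v → at-v a S.≈ con 1#
      at-v-off a a≢v with a ≟ v
      ... | yes a≡v = contradiction a≡v a≢v
      ... | no  _   = S.refl
      at-next-on : at-next (next v) S.≈ g (next v)
      at-next-on with prev (next v) ≟ v
      ... | yes _ = S.refl
      ... | no  ≢ = contradiction (prev-next v) ≢
      at-next-off : ∀ a → a ≢ next v → at-next a S.≈ con 1#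
      at-next-off a a≢ with prev a ≟ v
      ... | yes eq = contradiction (≡.trans (≡.sym (next-prev a)) (≡.cong next eq)) a≢
      ... | no  _  = S.refl

    module _ (h : EdgeColoringModel k) where

      M : Fin k → Fin k → Carrier
      M p q = ⟦ h ⟧ (e p ⊙ e q)

      -- `power m` is the matrix power with exponent m + 1, so no identity matrix is needed.
      power : ℕ → Fin k → Fin k → Carrier
      power zero    p q = M p q
      power (suc m) p q = sum λ l → M p l * power m l q

      power-* : ∀ m n p q → sum (λ l → power m p l * power n l q) ≈ power (suc (m ℕ.+ n)) p q
      power-* zero    n p q = refl
      power-* (suc m) n p q = begin
        sum (λ l → sum (λ s → M p s * power m s l) * power n l q)
          ≈⟨ sum-cong-≋ {k} (λ l → trans (*-distribʳ-sum {k} (power n l q) _)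
               (sum-cong-≋ {k} λ s → *-assoc _ _ _)) ⟩
        sum (λ l → sum λ s → M p s * (power m s l * power n l q))
          ≈⟨ ∑-comm {k} {k} _ ⟩
        sum (λ s → sum λ l → M p s * (power m s l * power n l q))
          ≈⟨ sum-cong-≋ {k} (λ s → trans (sym (*-distribˡ-sum {k} (M p s) _))
               (*-congˡ (power-* m n s q))) ⟩
        sum (λ s → M p s * power (suc (m ℕ.+ n)) s q) ∎

      -- The product runs over the m + 1 steps of a walk through the colours p, φ, q: `p ∷ φ` lists
      -- where the steps start and `snoc φ q` where they end.
      walks : ∀ m p q →
        sumMaps m (λ φ → product {suc m} λ v → M ((p Vector.∷ φ) v) (snoc φ q v)) ≈ power m p q
      walks zero    p q = *-identityʳ _
      walks (suc m) p q = sum-cong-≋ {k} λ l →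
        trans (sym (sumMaps-*ˡ m (M p l) _)) (*-congˡ (walks m l q))

      partitionFunction-cycle : ∀ n → partitionFunction h (cycle n) ≈ sum λ p → power n p p
      partitionFunction-cycle n = trans
        (sumMaps-cong (suc n) λ φ → product-cong {suc n} λ v → ⟦⟧-cong (⨀-δ (λ a → e (φ a)) v))
        (sum-cong-≋ {k} λ p → trans
          (sumMaps-cong n λ φ → product-cong {suc n} λ v →
            reflexive (≡.cong (M ((p Vector.∷ φ) v)) (snoc-map (p Vector.∷ φ) suc zero v)))
          (walks n p p))
        where
        open ModuleMorphisms.IsModuleHomomorphism (isLinear h)

-- Adjacency in a cycle of length at least three.

module _ {a p} {A : Set a} {P : Pred A p} (P? : Decidable P) where

  filter-tabulate-none : ∀ {n} (f : Fin n → A) → (∀ i → ¬ P (f i)) →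
                         length (filter P? (tabulate f)) ≡ 0
  filter-tabulate-none f ¬P = ≡.cong length (List.filter-none P? (All.tabulate⁺ ¬P))

  filter-tabulate-unique : ∀ {n} (f : Fin n → A) i → P (f i) → (∀ j → P (f j) → j ≡ i) →
                           length (filter P? (tabulate f)) ≡ 1
  filter-tabulate-unique f zero    Pi unique = ≡.trans
    (≡.cong length (List.filter-accept P? Pi))
    (≡.cong suc (filter-tabulate-none (f ∘ suc) λ j Pj → contradiction (unique (suc j) Pj) λ ()))
  filter-tabulate-unique f (suc i) Pi unique = ≡.trans
    (≡.cong length (List.filter-reject P? λ P0 → contradiction (unique zero P0) λ ()))
    (filter-tabulate-unique (f ∘ suc) i Pi λ j Pj → suc-injective (unique (suc j) Pj))

-- This fails for two vertices, where the edges are parallel. Together with `prev-≢`, which excludes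
-- loops, it makes every multiplicity 0 or 1.
prev-prev : ∀ {r} (i : Fin (3 ℕ.+ r)) → prev (prev i) ≢ i
prev-prev zero          ()
prev-prev (suc zero)    ()
prev-prev (suc (suc i)) eq = ℕ.m+1+n≢n 1 {toℕ i} (≡.trans (≡.cong toℕ (≡.sym eq))
  (≡.trans (toℕ-inject₁ (inject₁ i)) (toℕ-inject₁ i)))

prev-≢ : ∀ {r} (i : Fin (3 ℕ.+ r)) → prev i ≢ i
prev-≢ i eq = prev-prev i (≡.trans (≡.cong prev eq) eq)

-- A Boolean that computes on constructors, so that minors of the cycle matrix can be recognised by
-- `refl`.
adjacent : ∀ {n} → Fin (suc n) → Fin (suc n) → Bool
adjacent i j = does (prev j ≟ i) ∨ does (prev i ≟ j)

ends-prev : ∀ {n} {a i j : Fin (suc n)} → (a , prev a) ≡ (i , j) → prev i ≡ j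
ends-prev ≡.refl = ≡.refl

adjacency-cycle : ∀ r i j →
  Graph.adjacency (cycle (2 ℕ.+ r)) i j ≡ (if adjacent i j then 1 else 0)
adjacency-cycle r i j with i ≟ j
adjacency-cycle r i .i | yes ≡.refl with prev i ≟ i
... | yes eq = contradiction eq (prev-≢ i)
... | no  ≢i = ≡.cong (2 ℕ.*_) (filter-tabulate-none (Graph.joins? (cycle (2 ℕ.+ r)) i i) id
  λ { a (inj₁ eq) → ≢i (ends-prev eq) ; a (inj₂ eq) → ≢i (ends-prev eq) })
adjacency-cycle r i j | no i≢j with prev j ≟ i
... | yes ≡.refl = filter-tabulate-unique
  (Graph.joins? (cycle (2 ℕ.+ r)) (prev j) j) id j (inj₂ ≡.refl)
  λ { b (inj₁ eq) → contradiction
        (ends-prev eq) (prev-prev j)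
    ; b (inj₂ eq) → ≡.cong proj₁ eq }
... | no ≢i with prev i ≟ j
...   | yes ≡.refl = filter-tabulate-unique
  (Graph.joins? (cycle (2 ℕ.+ r)) i (prev i)) id i (inj₁ ≡.refl)
  λ { b (inj₁ eq) → ≡.cong proj₁ eq
    ; b (inj₂ eq) → contradiction
        (ends-prev eq) ≢i }
...   | no ≢j = filter-tabulate-none (Graph.joins? (cycle (2 ℕ.+ r)) i j) id
  λ { b (inj₁ eq) → ≢j (ends-prev eq)
    ; b (inj₂ eq) → ≢i (ends-prev eq) }

punchIn-fromℕ : ∀ {n} (l : Fin n) → punchIn (fromℕ n) l ≡ inject₁ l
punchIn-fromℕ zero    = ≡.refl
punchIn-fromℕ (suc l) = ≡.cong suc (punchIn-fromℕ l)

-- The determinant of a cycle.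

module CycleDet {c ℓ} (R : CommutativeRing c ℓ) where
  open CommutativeRing R hiding (zero)
  open EdgeColoring R using (det; charPoly; kronecker)
  open RawSemiringDefs (Semiring.rawSemiring semiring) using (_^_)
  open TraceIdentity R using (IsNat; IsPos; nat-+; nat-resp; pos-resp)
  open import Algebra.Definitions.RawMonoid +-rawMonoid using () renaming (_×_ to _·_)
  open import Algebra.Properties.Ring ring
  open import Algebra.Properties.Semiring.Sum semiring
  open SumSingle +-commutativeMonoid
  open import Relation.Binary.Reasoning.Setoid setoid
  open import Algebra.Solver.Ring.NaturalCoefficients.Default commutativeSemiring
    using (solve; _:+_; _:*_; _:=_) renaming (con to :con)

  Matrix : ℕ → Set c
  Matrix n = Fin n → Fin n → Carrier

  minor : ∀ {n} → Fin (suc n) → Matrix (suc n) → Matrix n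
  minor j A i l = A (suc i) (punchIn j l)

  det-cong : ∀ {n} (A B : Matrix n) → (∀ i j → A i j ≈ B i j) → det A ≈ det B
  det-cong {zero}  A B A≈B = refl
  det-cong {suc n} A B A≈B = sum-cong-≋ {suc n} λ j →
    *-cong (*-congˡ {(- 1#) ^ toℕ j} (A≈B zero j))
           (det-cong (minor j A) (minor j B) λ i l → A≈B (suc i) (punchIn j l))

  det-zero-column : ∀ {n} (A : Matrix n) j → (∀ i → A i j ≈ 0#) → det A ≈ 0#
  det-zero-column {suc n} A j A≈0 = sum-zero {suc n} _ term
    where
    term : ∀ l → (- 1#) ^ toℕ l * A zero l * det (minor l A) ≈ 0#
    term l with l ≟ j
    ... | yes ≡.refl = trans (*-congʳ (trans (*-congˡ (A≈0 zero)) (zeroʳ _))) (zeroˡ _)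
    ... | no  l≢j    = trans (*-congˡ (det-zero-column (minor l A) (punchOut l≢j) λ i →
            trans (reflexive (≡.cong (A (suc i)) (punchIn-punchOut l≢j))) (A≈0 (suc i)))) (zeroʳ _)

  zero-entry : ∀ {s x} d → x ≈ 0# → s * x * d ≈ 0#
  zero-entry d x≈0 = trans (*-congʳ (trans (*-congˡ x≈0) (zeroʳ _))) (zeroˡ d)

  zero-minor : ∀ {s x d} → d ≈ 0# → s * x * d ≈ 0#
  zero-minor d≈0 = trans (*-congˡ d≈0) (zeroʳ _)

  -1*-1≈1 : - 1# * - 1# ≈ 1#
  -1*-1≈1 = trans (-1*x≈-x (- 1#)) (-‿involutive 1#)

  sign-square : ∀ n → (- 1#) ^ n * (- 1#) ^ n ≈ 1#
  sign-square zero    = *-identityˡ 1#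
  sign-square (suc n) = begin
    - 1# * s * (- 1# * s)
      ≈⟨ solve 2 (λ m s → m :* s :* (m :* s) := m :* m :* (s :* s)) refl (- 1#) s ⟩
    - 1# * - 1# * (s * s)      ≈⟨ *-cong -1*-1≈1 (sign-square n) ⟩
    1# * 1#                    ≈⟨ *-identityˡ 1# ⟩
    1#                         ∎
    where s = (- 1#) ^ n

  ⟪_⟫ : Bool → Carrier
  ⟪ b ⟫ = if b then - 1# else 0#

  -- Equal by computation to `adjacent (suc i) (suc j)`: removing vertex 0 from a cycle leaves a
  -- path.
  tri : ∀ {n} → Fin n → Fin n → Bool
  tri i j = does (inject₁ j ≟ suc i) ∨ does (inject₁ i ≟ suc j)

  path : ∀ {n} → Matrix n
  path i j = ⟪ tri i j ⟫

  pathDet : ℕ → Carrier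
  pathDet 0             = 1#
  pathDet 1             = 0#
  pathDet (suc (suc n)) = - pathDet n

  -- With an arbitrary first column, path matrices are closed under the minors
  -- of the first-row expansion.
  K : ∀ {n} → (Fin n → Carrier) → Matrix n
  K c i zero    = c i
  K c i (suc j) = path i (suc j)

  det-K₁ : ∀ (c : Fin 1 → Carrier) → det (K c) ≈ c zero
  det-K₁ c = trans (+-identityʳ _) (trans (*-identityʳ _) (*-identityˡ _))

  -- Apart from c 0, row 0 has only the entry -1 in column 1, which the expansion sign turns into 1.
  -- Deleting that column leaves a matrix of the same shape with the first column shifted up.
  det-K : ∀ {n} (c : Fin (2 ℕ.+ n) → Carrier) →
          det (K c) ≈ c zero * det (path {1 ℕ.+ n}) + det (K (c ∘ suc))
  det-K {n} c = +-cong (*-congʳ (*-identityˡ _)) (begin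
    - 1# * 1# * - 1# * det (minor (suc zero) (K c)) +
    sum (λ j → (- 1#) ^ (2 ℕ.+ toℕ j) * 0# * det (minor (suc (suc j)) (K c)))
      ≈⟨ +-cong
           (*-cong (trans (*-congʳ (*-identityʳ _)) -1*-1≈1)
             (det-cong (minor (suc zero) (K c)) (K (c ∘ suc))
               λ { i zero → refl ; i (suc l) → refl }))
           (sum-zero {n} _ λ j → zero-entry _ refl) ⟩
    1# * det (K (c ∘ suc)) + 0#  ≈⟨ trans (+-identityʳ _) (*-identityˡ _) ⟩
    det (K (c ∘ suc)) ∎)

  det-path : ∀ n → det (path {n}) ≈ pathDet n
  det-path 0 = refl
  det-path 1 = trans (+-identityʳ _) (zero-entry _ refl)
  det-path (suc (suc n)) = begin
    det (path {2 ℕ.+ n})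
      ≈⟨ det-cong (path {2 ℕ.+ n}) (K λ i → path i zero) (λ { i zero → refl ; i (suc j) → refl }) ⟩
    det (K {2 ℕ.+ n} (λ i → path i zero))
      ≈⟨ det-K {n} (λ i → path i zero) ⟩
    0# * det (path {1 ℕ.+ n}) + det (K {1 ℕ.+ n} (λ i → path (suc i) zero))
      ≈⟨ trans (+-congʳ (zeroˡ _)) (+-identityˡ _) ⟩
    det (K {1 ℕ.+ n} (λ i → path (suc i) zero))
      ≈⟨ endpoint n ⟩
    - pathDet n ∎
    where
    -- The first column is now -1 followed by zeros: the end vertex is matched with its only
    -- neighbour, leaving a path on n vertices and a sign.
    endpoint : ∀ n → det (K {1 ℕ.+ n} (λ i → path (suc i) zero)) ≈ - pathDet n
    endpoint zero    = det-K₁ (λ i → path (suc i) zero)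
    endpoint (suc n) = begin
      det (K {2 ℕ.+ n} (λ i → path (suc i) zero))
        ≈⟨ det-K {n} (λ i → path (suc i) zero) ⟩
      - 1# * det (path {1 ℕ.+ n}) + det (K {1 ℕ.+ n} (λ i → path (suc (suc i)) zero))
        ≈⟨ +-cong (trans (-1*x≈-x _) (-‿cong (det-path (suc n))))
                  (det-zero-column (K {1 ℕ.+ n} (λ i → path (suc (suc i)) zero)) zero λ i → refl) ⟩
      - pathDet (suc n) + 0#  ≈⟨ +-identityʳ _ ⟩
      - pathDet (suc n)       ∎

  E₀ E₁ : ∀ {n} → Fin n → Carrier
  E₀ zero    = - 1#
  E₀ (suc _) = 0#
  E₁ zero    = 0#
  E₁ (suc i) = E₀ i

  -- Minus the last unit vector, coming from the edge that closes the cycle.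
  final : ∀ {n} → Fin (suc n) → Carrier
  final {n} i = ⟪ does (fromℕ n ≟ i) ⟫

  det-K-final : ∀ n → det (K {suc n} final) ≈ - 1#
  det-K-final zero    = det-K₁ final
  det-K-final (suc n) = begin
    det (K {2 ℕ.+ n} final)  ≈⟨ det-K {n} final ⟩
    0# * det (path {1 ℕ.+ n}) + det (K {1 ℕ.+ n} final)
      ≈⟨ +-cong (zeroˡ _) (det-K-final n) ⟩
    0# + - 1#  ≈⟨ +-identityˡ _ ⟩
    - 1#       ∎

  -- Deleting row 0 and the last column of the cycle matrix moves its diagonals
  -- to the rows j − 2 and j of column j; the first-row expansion then needs two
  -- arbitrary columns.
  Y : ∀ {n} → (Fin n → Carrier) → (Fin n → Carrier) → Matrix n
  Y c d i zero          = c i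
  Y c d i (suc zero)    = d i
  Y c d i (suc (suc l)) = ⟪ tri i (suc (inject₁ l)) ⟫

  tri-E₁ : ∀ {n} (i : Fin (suc n)) → ⟪ tri i zero ⟫ ≈ E₁ i
  tri-E₁ zero          = refl
  tri-E₁ (suc zero)    = refl
  tri-E₁ (suc (suc i)) = refl

  minor₀-Y : ∀ {n} (c : Fin (suc n) → Carrier) i l → minor zero (Y c E₁) i l ≈ Y E₀ E₁ i l
  minor₀-Y c i zero          = refl
  minor₀-Y c i (suc zero)    = tri-E₁ i
  minor₀-Y c i (suc (suc l)) = refl

  -- The matrix is upper triangular with diagonal -1, since column j ≥ 2 meets only rows j - 2 and
  -- j.
  det-Y-upper : ∀ n → det (Y {n} E₀ E₁) ≈ (- 1#) ^ n
  det-Y-upper zero    = refl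
  det-Y-upper (suc n) = begin
    1# * - 1# * det (minor zero (Y {suc n} E₀ E₁)) +
    sum (λ j → (- 1#) ^ suc (toℕ j) * Y E₀ E₁ zero (suc j) * det (minor (suc j) (Y {suc n} E₀ E₁)))
      ≈⟨ +-cong (*-cong (*-identityˡ _)
                  (trans (det-cong (minor zero (Y E₀ E₁)) (Y E₀ E₁) (minor₀-Y {n} E₀))
                         (det-Y-upper n)))
                (sum-zero {n} _ λ { zero → zero-entry _ refl ; (suc j) → zero-minor
                  (det-zero-column (minor (suc (suc j)) (Y E₀ E₁)) zero λ i → refl) }) ⟩
    - 1# * (- 1#) ^ n + 0#  ≈⟨ +-identityʳ _ ⟩
    - 1# * (- 1#) ^ n       ∎

  -- In effect an expansion along column 1, whose only nonzero entry, -1 in row 0, has cofactor sign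
  -- -1.
  det-Y-E₀ : ∀ n (c : Fin (2 ℕ.+ n) → Carrier) → det (Y c E₀) ≈ det (Y (c ∘ suc) E₁)
  det-Y-E₀ n c = begin
    1# * c zero * det (minor zero (Y c E₀)) +
    (- 1# * 1# * - 1# * det (minor (suc zero) (Y c E₀)) +
     sum (λ j → (- 1#) ^ (2 ℕ.+ toℕ j) * Y c E₀ zero (suc (suc j)) *
                det (minor (suc (suc j)) (Y c E₀))))
      ≈⟨ +-cong
           (zero-minor (det-zero-column (minor zero (Y c E₀)) zero λ i → refl))
           (+-cong
             (*-cong (trans (*-congʳ (*-identityʳ _)) -1*-1≈1)
               (det-cong (minor (suc zero) (Y c E₀)) (Y (c ∘ suc) E₁) minor₁))
             (sum-zero {n} _ λ
               { zero    → zero-minor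
                   (det-zero-column (minor (suc (suc zero)) (Y c E₀)) (suc zero) λ i → refl)
               ; (suc j) → zero-entry _ refl })) ⟩
    0# + (1# * det (Y (c ∘ suc) E₁) + 0#)
      ≈⟨ trans (+-identityˡ _) (trans (+-identityʳ _) (*-identityˡ _)) ⟩
    det (Y (c ∘ suc) E₁) ∎
    where
    minor₁ : ∀ i l → minor (suc zero) (Y c E₀) i l ≈ Y (c ∘ suc) E₁ i l
    minor₁ i zero          = refl
    minor₁ i (suc zero)    = tri-E₁ i
    minor₁ i (suc (suc l)) = refl

  -- Row 0 is c 0, 0, -1, 0, .... Deleting column 0 leaves the triangular matrix; deleting column 2
  -- leaves the shape of `det-Y-E₀`, so the recursion descends by two.
  det-Y-E₁ : ∀ n (c : Fin (3 ℕ.+ n) → Carrier) →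
             det (Y c E₁) ≈ c zero * (- 1#) ^ (2 ℕ.+ n) + - det (Y (λ i → c (suc (suc i))) E₁)
  det-Y-E₁ n c = +-cong
    (*-cong (*-identityˡ _)
      (trans (det-cong (minor zero (Y c E₁)) (Y E₀ E₁) (minor₀-Y {2 ℕ.+ n} c))
             (det-Y-upper (2 ℕ.+ n))))
    (begin
      - 1# * 1# * 0# * det (minor (suc zero) (Y c E₁)) +
      (- 1# * (- 1# * 1#) * - 1# * det (minor (suc (suc zero)) (Y c E₁)) +
       sum (λ j → (- 1#) ^ (3 ℕ.+ toℕ j) * 0# * det (minor (suc (suc (suc j))) (Y c E₁))))
        ≈⟨ +-cong (zero-entry _ refl)
             (+-cong
               (*-cong
                 (trans (*-congʳ (trans (*-congˡ (*-identityʳ _)) -1*-1≈1)) (*-identityˡ _))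
                 (trans (det-cong (minor (suc (suc zero)) (Y c E₁)) (Y (c ∘ suc) E₀) minor₂)
                        (det-Y-E₀ n (c ∘ suc))))
               (sum-zero {n} _ λ j → zero-entry _ refl)) ⟩
      0# + (- 1# * det (Y (λ i → c (suc (suc i))) E₁) + 0#)
        ≈⟨ trans (+-identityˡ _) (trans (+-identityʳ _) (-1*x≈-x _)) ⟩
      - det (Y (λ i → c (suc (suc i))) E₁) ∎)
    where
    minor₂ : ∀ i l → minor (suc (suc zero)) (Y c E₁) i l ≈ Y (c ∘ suc) E₀ i l
    minor₂ i zero          = refl
    minor₂ i (suc zero)    = refl
    minor₂ i (suc (suc l)) = refl

  -- A sign change for every two rows is also the recursion of `pathDet`, which lets this result
  -- combine with the contribution of column 1.
  det-Y-final : ∀ n → det (Y {suc n} final E₁) ≈ (- 1#) ^ n * pathDet (2 ℕ.+ n)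
  det-Y-final zero = trans (+-identityʳ _)
    (trans (*-congʳ (*-identityˡ _)) (*-comm _ _))
  det-Y-final (suc zero) = begin
    1# * 0# * _ + (- 1# * 1# * 0# * _ + 0#)
      ≈⟨ +-cong (zero-entry _ refl) (trans (+-identityʳ _) (zero-entry _ refl)) ⟩
    0# + 0#                  ≈⟨ trans (+-identityˡ _) (sym (trans (*-congˡ -0#≈0#) (zeroʳ _))) ⟩
    (- 1#) ^ 1 * - 0#        ∎
  det-Y-final (suc (suc n)) = begin
    det (Y {3 ℕ.+ n} final E₁)                               ≈⟨ det-Y-E₁ n final ⟩
    0# * (- 1#) ^ (2 ℕ.+ n) + - det (Y {suc n} final E₁)
      ≈⟨ trans (+-congʳ (zeroˡ _)) (+-identityˡ _) ⟩
    - det (Y {suc n} final E₁)                               ≈⟨ -‿cong (det-Y-final n) ⟩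
    - (s * p)                                                ≈⟨ -‿distribʳ-* s p ⟩
    s * - p
      ≈⟨ *-congʳ (trans (sym (*-identityˡ s)) (*-congʳ (sym -1*-1≈1))) ⟩
    - 1# * - 1# * s * - p                                    ≈⟨ *-congʳ (*-assoc _ _ _) ⟩
    (- 1#) ^ (2 ℕ.+ n) * - p                                 ∎
    where
    s = (- 1#) ^ n
    p = pathDet (2 ℕ.+ n)

  -- The column of the cycle matrix belonging to vertex 0, without its first
  -- entry.
  corner : ∀ {r} → Fin (2 ℕ.+ r) → Carrier
  corner zero    = - 1#
  corner (suc i) = final i

  det-Y-corner : ∀ r → det (Y {2 ℕ.+ r} corner E₁) ≈ (- 1#) ^ r * (1# + pathDet (1 ℕ.+ r))
  det-Y-corner zero = begin
    1# * - 1# * det (minor zero (Y {2} corner E₁)) + (- 1# * 1# * 0# * _ + 0#)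
      ≈⟨ +-cong (*-cong (*-identityˡ _)
                  (trans (+-identityʳ _) (trans (*-identityʳ _) (*-identityˡ _))))
                (trans (+-identityʳ _) (zero-entry _ refl)) ⟩
    - 1# * - 1# + 0#  ≈⟨ +-congʳ -1*-1≈1 ⟩
    1# + 0#           ≈⟨ *-identityˡ _ ⟨
    1# * (1# + 0#)    ∎
  det-Y-corner (suc n) = begin
    det (Y {3 ℕ.+ n} corner E₁)  ≈⟨ det-Y-E₁ n corner ⟩
    - 1# * (- 1# * (- 1# * s)) + - det (Y {suc n} final E₁)
      ≈⟨ +-cong (*-congˡ (trans (sym (*-assoc _ _ _)) (trans (*-congʳ -1*-1≈1) (*-identityˡ s))))
                (trans (-‿cong (det-Y-final n)) (sym (-1*x≈-x _))) ⟩
    - 1# * s + - 1# * (s * p)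
      ≈⟨ solve 3 (λ m s p → m :* s :+ m :* (s :* p) := m :* s :* (:con 1 :+ p)) refl (- 1#) s p ⟩
    - 1# * s * (1# + p) ∎
    where
    s = (- 1#) ^ n
    p = pathDet (2 ℕ.+ n)

  cycleMatrix : ∀ r → Matrix (3 ℕ.+ r)
  cycleMatrix r i j = ⟪ adjacent i j ⟫

  cycleMatrix-corner : ∀ r i → cycleMatrix r (suc i) zero ≈ corner i
  cycleMatrix-corner r zero    = refl
  cycleMatrix-corner r (suc i) = reflexive (≡.cong ⟪_⟫ (Bool.∨-identityʳ _))

  -- Row 0 meets only the columns of the two neighbours of vertex 0, and each contributes -β. In β
  -- the 1 comes from going once around the cycle in one direction, and `pathDet (1 + r)` from
  -- matching vertex 0 with that neighbour, which leaves a path.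
  det-cycleMatrix : ∀ r →
    - det (cycleMatrix r) ≈ (1# + pathDet (1 ℕ.+ r)) + (1# + pathDet (1 ℕ.+ r))
  det-cycleMatrix r = trans (-‿cong expand) (trans (-‿cong collect) (-‿involutive _))
    where
    C = cycleMatrix r
    β = 1# + pathDet (1 ℕ.+ r)
    s = (- 1#) ^ r
    far : Fin (1 ℕ.+ r) → Carrier
    far j = (- 1#) ^ (2 ℕ.+ toℕ j) * C zero (suc (suc j)) * det (minor (suc (suc j)) C)
    minor₁ : ∀ i l → minor (suc zero) C i l ≈ K corner i l
    minor₁ i zero    = cycleMatrix-corner r i
    minor₁ i (suc l) = refl
    minor-last : ∀ i l → minor (fromℕ (2 ℕ.+ r)) C i l ≈ Y corner E₁ i l
    minor-last i l = trans (reflexive (≡.cong (C (suc i)) (punchIn-fromℕ l))) (shape l)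
      where
      shape : ∀ l → C (suc i) (inject₁ l) ≈ Y corner E₁ i l
      shape zero          = cycleMatrix-corner r i
      shape (suc zero)    = tri-E₁ i
      shape (suc (suc l)) = refl
    far-zero : ∀ j → j ≢ fromℕ r → far j ≈ 0#
    far-zero j j≢ with fromℕ r ≟ j
    ... | yes eq = contradiction (≡.sym eq) j≢
    ... | no  _  = zero-entry _ refl
    far-last : far (fromℕ r) ≈ - 1# * β
    far-last with fromℕ r ≟ fromℕ r
    ... | no ≢  = contradiction ≡.refl ≢
    ... | yes _ = begin
      - 1# * (- 1# * (- 1#) ^ toℕ (fromℕ r)) * - 1# * det (minor (fromℕ (2 ℕ.+ r)) C)
        ≈⟨ *-cong (*-congʳ (trans (sym (*-assoc _ _ _)) (trans (*-congʳ -1*-1≈1)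
             (trans (*-identityˡ _) (reflexive (≡.cong ((- 1#) ^_) (toℕ-fromℕ r)))))))
             (trans (det-cong (minor (fromℕ (2 ℕ.+ r)) C) (Y corner E₁) minor-last)
                    (det-Y-corner r)) ⟩
      -- The expansion sign of the last column and the sign in `det-Y-corner` are both (-1)^r and
      -- cancel.
      s * - 1# * (s * β)
        ≈⟨ solve 3 (λ s m b → s :* m :* (s :* b) := s :* s :* (m :* b)) refl s (- 1#) β ⟩
      s * s * (- 1# * β)  ≈⟨ trans (*-congʳ (sign-square r)) (*-identityˡ _) ⟩
      - 1# * β            ∎
    near : det (minor (suc zero) C) ≈ - 1# * β
    near = begin
      det (minor (suc zero) C)
        ≈⟨ det-cong (minor (suc zero) C) (K corner) minor₁ ⟩
      det (K {2 ℕ.+ r} corner)                                ≈⟨ det-K {r} corner ⟩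
      - 1# * det (path {1 ℕ.+ r}) + det (K {1 ℕ.+ r} final)
        ≈⟨ +-cong (*-congˡ (det-path (1 ℕ.+ r))) (det-K-final r) ⟩
      - 1# * pathDet (1 ℕ.+ r) + - 1#
        ≈⟨ solve 2 (λ m p → m :* p :+ m := m :* (:con 1 :+ p)) refl (- 1#) (pathDet (1 ℕ.+ r)) ⟩
      - 1# * β ∎
    expand : det C ≈ - 1# * β + - 1# * β
    expand = begin
      1# * 0# * det (minor zero C) + (- 1# * 1# * - 1# * det (minor (suc zero) C) + sum far)
        ≈⟨ +-cong (zero-entry _ refl)
             (+-cong (*-cong (trans (*-congʳ (*-identityʳ _)) -1*-1≈1) near)
                     (trans (sum-single far (fromℕ r) far-zero) far-last)) ⟩
      0# + (1# * (- 1# * β) + - 1# * β)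
        ≈⟨ trans (+-identityˡ _) (+-congʳ (*-identityˡ _)) ⟩
      - 1# * β + - 1# * β ∎
    collect : - 1# * β + - 1# * β ≈ - (β + β)
    collect = trans (sym (distribˡ _ β β)) (-1*x≈-x _)

  charPoly-cycle : ∀ r → charPoly (cycle (2 ℕ.+ r)) 0# ≈ det (cycleMatrix r)
  charPoly-cycle r = det-cong
    (λ i j → 0# * kronecker i j - Graph.adjacency (cycle (2 ℕ.+ r)) i j · 1#)
    (cycleMatrix r) λ i j → trans (+-cong (zeroˡ (kronecker i j))
      (-‿cong (reflexive (≡.cong (_· 1#) (adjacency-cycle r i j)))))
    (trans (+-identityˡ _) (entry (adjacent i j)))
    where
    entry : ∀ b → - ((if b then 1 else 0) · 1#) ≈ ⟪ b ⟫
    entry true  = -‿cong (+-identityʳ 1#)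
    entry false = -0#≈0#

  -- Both signs are carried along because the recursion negates `pathDet` and thereby exchanges the
  -- two claims.
  pathDet-nat : ∀ n → IsNat (1# + pathDet n) × IsNat (1# + - pathDet n)
  pathDet-nat 0 = (2 , +-congˡ (sym (+-identityʳ 1#))) , (0 , -‿inverseʳ 1#)
  pathDet-nat 1 = (1 , refl) , (1 , +-congˡ -0#≈0#)
  pathDet-nat (suc (suc n)) =
    let p , q = pathDet-nat n
    in q , nat-resp (+-congˡ (-‿involutive _)) p

  charPoly-cycle-nat : ∀ r → IsNat (- charPoly (cycle (2 ℕ.+ r)) 0#)
  charPoly-cycle-nat r = nat-resp (trans (-‿cong (charPoly-cycle r)) (det-cycleMatrix r))
    (nat-+ p p)
    where p = proj₁ (pathDet-nat (suc r))

  charPoly-triangle-pos : IsPos (- charPoly (cycle 2) 0#)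
  charPoly-triangle-pos = pos-resp (trans (-‿cong (charPoly-cycle 0)) (det-cycleMatrix 0))
    -- The witness 1 stands for the multiple 2: `pathDet 1` is 0, so both halves equal 1.
    (1 , trans (+-congʳ (+-identityʳ 1#)) refl)

-- The contradiction in characteristic zero.

module CharacteristicZero {c ℓ} (R : CommutativeRing c ℓ) where
  open CommutativeRing R hiding (zero)
  open EdgeColoring R using (EdgeColoringModel; partitionFunction; charPoly)
  open TraceIdentity R using (nat-resp; pos-resp; positive-trace-absurd)
  open Cycle R using (power; power-*; partitionFunction-cycle)
  open CycleDet R using (charPoly-cycle-nat; charPoly-triangle-pos)
  open import Algebra.Definitions.RawMonoid +-rawMonoid using () renaming (_×_ to _·_)
  open import Algebra.Properties.Ring ring using (-1*x≈-x; -‿involutive; -‿distribʳ-*)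
  open import Algebra.Properties.Semiring.Sum semiring
  open import Relation.Binary.Reasoning.Setoid setoid

  sum-neg : ∀ {n} (f : Fin n → Carrier) → sum (λ i → - f i) ≈ - sum f
  sum-neg {n} f = begin
    sum (λ i → - f i)       ≈⟨ sum-cong-≋ {n} (λ i → -1*x≈-x (f i)) ⟨
    sum (λ i → - 1# * f i)  ≈⟨ *-distribˡ-sum {n} (- 1#) f ⟨
    - 1# * sum f            ≈⟨ -1*x≈-x _ ⟩
    - sum f                 ∎

  charPoly≉partitionFunction : (∀ n → ¬ suc n · 1# ≈ 0#) →
    ∀ {k} (h : EdgeColoringModel k) → ¬ (∀ G → partitionFunction h G ≈ charPoly G 0#)
  charPoly≉partitionFunction char0 {k} h eq =
    positive-trace-absurd _⊕_ Y Y-⊕ char0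
      (λ a → nat-resp (trace-Y a) (charPoly-cycle-nat a))
      -- Index 0 is -M³, whose trace is read off from the triangle.
      {0} (pos-resp (trace-Y 0) charPoly-triangle-pos)
    where
    -- Y a is −M^(a+3), since power h n is M^(n+1).
    _⊕_ : ℕ → ℕ → ℕ
    a ⊕ b = suc (a ℕ.+ (2 ℕ.+ b))
    Y : ℕ → Fin k → Fin k → Carrier
    Y a p q = - power h (2 ℕ.+ a) p q
    Y-⊕ : ∀ a b p q → sum (λ l → - Y a p l * Y b l q) ≈ Y (a ⊕ b) p q
    Y-⊕ a b p q = begin
      sum (λ l → - Y a p l * Y b l q)
        ≈⟨ sum-cong-≋ {k} (λ l → trans (*-congʳ (-‿involutive _)) (sym (-‿distribʳ-* _ _))) ⟩
      sum (λ l → - (power h (2 ℕ.+ a) p l * power h (2 ℕ.+ b) l q))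
        ≈⟨ sum-neg {k} _ ⟩
      - sum (λ l → power h (2 ℕ.+ a) p l * power h (2 ℕ.+ b) l q)
        -- Exponents add: (a + 3) + (b + 3) = (a ⊕ b) + 3, and the index given by `power-*` unfolds
        -- to 2 + (a ⊕ b).
        ≈⟨ -‿cong (power-* h (2 ℕ.+ a) (2 ℕ.+ b) p q) ⟩
      Y (a ⊕ b) p q ∎
    trace-Y : ∀ a → sum (λ q → Y a q q) ≈ - charPoly (cycle (2 ℕ.+ a)) 0#
    trace-Y a = begin
      sum (λ q → Y a q q)                       ≈⟨ sum-neg {k} _ ⟩
      - sum (λ q → power h (2 ℕ.+ a) q q)       ≈⟨ -‿cong (partitionFunction-cycle h (2 ℕ.+ a)) ⟨
      - partitionFunction h (cycle (2 ℕ.+ a))   ≈⟨ -‿cong (eq (cycle (2 ℕ.+ a))) ⟩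
      - charPoly (cycle (2 ℕ.+ a)) 0#           ∎

-- Characteristic zero of ℂ, and the conclusion.

open import Defs

open RawMonoidDefs (CommutativeRing.+-rawMonoid ℂ-commutativeRing) using () renaming (_×_ to _·_)

ℕ·1-nonneg : ∀ n i → 0ℚ ℚ.≤ seq (re (n · 1ℂ)) i
ℕ·1-nonneg zero    i = ℚ.≤-refl
ℕ·1-nonneg (suc n) i = ℚ.+-mono-≤ {0ℚ} {1ℚ} (ℚ.nonNegative⁻¹ 1ℚ) (ℕ·1-nonneg n i)

-- All terms of the rational sequence for the real part are at least 1, so it fails to be null
-- already for ε = 1.
ℂ-characteristic-zero : ∀ n → ¬ suc n · 1ℂ ≈ℂ 0ℂ
ℂ-characteristic-zero n eq =
  let N , close = null (re≈ eq) 1ℚ (ℚ.positive⁻¹ 1ℚ)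
      x = seq (re (suc n · 1ℂ)) N
      ∣x-0∣≡x = ≡.trans (≡.cong ℚ.∣_∣ (ℚ.+-identityʳ x)) (ℚ.0≤p⇒∣p∣≡p (ℕ·1-nonneg (suc n) N))
      1≤x = ℚ.+-mono-≤ {1ℚ} {1ℚ} ℚ.≤-refl (ℕ·1-nonneg n N)
  in ℚ.<-irrefl ≡.refl (ℚ.<-≤-trans (≡.subst (ℚ._< 1ℚ) ∣x-0∣≡x (close N ℕ.≤-refl)) 1≤x)

proposition9 : ¬ (Σ[ k ∈ ℕ ] Σ[ h ∈ EdgeColoringModel k ]
    ((G : Graph) → partitionFunction h G ≈ℂ charPoly G 0ℂ))
proposition9 (k , h , eq) = CharacteristicZero.charPoly≉partitionFunction
  ℂ-commutativeRing ℂ-characteristic-zero h eq
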